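{- Let $\zeta(3)=\sum_{n=1}^{\infty} n^{ -3}$. Then $$2\zeta(3)=b^{(1)}_0+\frac{a^{(1)}_1\vert}{\vert b^{(1)}_1}+\frac{a^{(1)}_2\vert}{\vert b^{(1)}_2}+\cdots+\frac{a^{(1)}_\nu\vert}{\vert b^{(1)}_\nu}+\cdots$$ and $$2\zeta(3)=b^{(2)}_0+\frac{a^{(2)}_1\vert}{\vert b^{(2)}_1}+\frac{a^{(2)}_2\vert}{\vert b^{(2)}_2}+\cdots+\frac{a^{(2)}_\nu\vert}{\vert b^{(2)}_\nu}+\cdots,$$ where $b^{(1)}_0=3$, $a^{(1)}_1=-81$, $a^{(1)}_\nu=-(\nu-1)^3\nu^3(4\nu^2-4\nu-3)^3$ for integers $\nu\ge 2$, and $b^{(1)}_\nu=4(68\nu^6-45\nu^4+12\nu^2-1)$ for integers $\nu\ge1$; and $b^{(2)}_0=2$, $a^{(2)}_1=42$, $a^{(2)}_\nu=-(\nu-1)^3\nu^3(4\nu^2-4\nu-3)\big((\nu+1)^3-\nu^3\big)\big((\nu-1)^3-(\nu-2)^3\big)$ for integers $\nu\ge2$, and $b^{(2)}_\nu=2(102\nu^6-68\nu^4+21\nu^2-3)$ for integers $\nu\ge1$.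
   Context: For sequences $(b_\nu)_{\nu\ge0}$ and $(a_\nu)_{\nu\ge1}$, the continued fraction $b_0+\frac{a_1\vert}{\vert b_1}+\frac{a_2\vert}{\vert b_2}+\cdots$ denotes $b_0+\cfrac{a_1}{b_1+\cfrac{a_2}{b_2+\cdots}}$, i.e. the limit as $\nu\to\infty$ of the convergents $P_\nu/Q_\nu$, where $P_\nu,Q_\nu$ satisfy $x_{\nu+1}=b_{\nu+1}x_\nu+a_{\nu+1}x_{\nu-1}$ for $\nu\ge0$ with $P_{ -1}=1$, $Q_{ -1}=0$, $P_0=b_0$, $Q_0=1$. The claim asserts that these convergents (well defined, i.e. with nonzero denominators) converge to $2\zeta(3)$. -}

module Defs where

open import Data.Nat as ℕ using (ℕ; zero; suc; _≤_)
open import Data.Integer as ℤ using (ℤ; +_; -[1+_])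
open import Data.Rational as ℚ using (ℚ; 0ℚ)
open import Data.Product using (Σ; ∃; _×_; _,_; proj₁; proj₂)
open import Data.Empty using (⊥-elim)
open import Relation.Binary.PropositionalEquality using (_≡_; _≢_; refl)

-- Generic continued fraction b₀ + a₁|/|b₁ + a₂|/|b₂ + ⋯ with integer entries.
-- ContRec a b x₋₁ x₀ ν = (x_ν , x_{ν-1}) where x_{ν+1} = b_{ν+1} x_ν + a_{ν+1} x_{ν-1}.
ContRec : (ℕ → ℤ) → (ℕ → ℤ) → ℤ → ℤ → ℕ → ℤ × ℤ
ContRec a b xm1 x0 zero    = x0 , xm1
ContRec a b xm1 x0 (suc ν) with ContRec a b xm1 x0 ν
... | u , v = b (suc ν) ℤ.* u ℤ.+ a (suc ν) ℤ.* v , u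

Num : (ℕ → ℤ) → (ℕ → ℤ) → ℕ → ℤ
Num a b ν = proj₁ (ContRec a b (+ 1) (b 0) ν)

Den : (ℕ → ℤ) → (ℕ → ℤ) → ℕ → ℤ
Den a b ν = proj₁ (ContRec a b (+ 0) (+ 1) ν)

ratio : (p q : ℤ) → q ≢ + 0 → ℚ
ratio p (+ zero)  h = ⊥-elim (h refl)
ratio p (+ suc n) h = p ℚ./ suc n
ratio p -[1+ n ]  h = (ℤ.- p) ℚ./ suc n

ζ3-partial : ℕ → ℚ
ζ3-partial zero    = 0ℚ
ζ3-partial (suc n) = ζ3-partial n ℚ.+ (+ 1) ℚ./ (suc n ℕ.^ 3)

-- "The convergents P_ν/Q_ν are well defined (Q_ν ≠ 0 for all ν) and converge to 2ζ(3)".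
-- Since ζ(3) is the real number given by the Cauchy sequence (S_N), convergence of
-- P_ν/Q_ν to 2ζ(3) is expressed as: for every rational ε > 0 there is N with
-- |P_n/Q_n − 2 S_m| < ε for all n, m ≥ N.
CFConvergesTo2ζ3 : (ℕ → ℤ) → (ℕ → ℤ) → Set
CFConvergesTo2ζ3 a b =
  Σ (∀ ν → Den a b ν ≢ + 0) λ nz →
    ∀ (ε : ℚ) → 0ℚ ℚ.< ε →
      ∃ λ N → ∀ n m → N ≤ n → N ≤ m →
        ℚ.∣ ratio (Num a b n) (Den a b n) (nz n) ℚ.- (ℚ.1ℚ ℚ.+ ℚ.1ℚ) ℚ.* ζ3-partial m ∣ ℚ.< ε

a⁽¹⁾ : ℕ → ℤ
a⁽¹⁾ zero          = + 0   -- unused (a₀ does not occur)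
a⁽¹⁾ (suc zero)    = ℤ.- (+ 81)
a⁽¹⁾ (suc (suc k)) =
  let ν = + (suc (suc k)) in
  ℤ.- ((ν ℤ.- + 1) ℤ.^ 3 ℤ.* ν ℤ.^ 3 ℤ.* (+ 4 ℤ.* ν ℤ.^ 2 ℤ.- + 4 ℤ.* ν ℤ.- + 3) ℤ.^ 3)

b⁽¹⁾ : ℕ → ℤ
b⁽¹⁾ zero    = + 3
b⁽¹⁾ (suc k) =
  let ν = + (suc k) in
  + 4 ℤ.* (+ 68 ℤ.* ν ℤ.^ 6 ℤ.- + 45 ℤ.* ν ℤ.^ 4 ℤ.+ + 12 ℤ.* ν ℤ.^ 2 ℤ.- + 1)

a⁽²⁾ : ℕ → ℤ
a⁽²⁾ zero          = + 0   -- unused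
a⁽²⁾ (suc zero)    = + 42
a⁽²⁾ (suc (suc k)) =
  let ν = + (suc (suc k)) in
  ℤ.- ((ν ℤ.- + 1) ℤ.^ 3 ℤ.* ν ℤ.^ 3 ℤ.* (+ 4 ℤ.* ν ℤ.^ 2 ℤ.- + 4 ℤ.* ν ℤ.- + 3)
        ℤ.* ((ν ℤ.+ + 1) ℤ.^ 3 ℤ.- ν ℤ.^ 3)
        ℤ.* ((ν ℤ.- + 1) ℤ.^ 3 ℤ.- (ν ℤ.- + 2) ℤ.^ 3))

b⁽²⁾ : ℕ → ℤ
b⁽²⁾ zero    = + 2
b⁽²⁾ (suc k) =
  let ν = + (suc k) in
  + 2 ℤ.* (+ 102 ℤ.* ν ℤ.^ 6 ℤ.- + 68 ℤ.* ν ℤ.^ 4 ℤ.+ + 21 ℤ.* ν ℤ.^ 2 ℤ.- + 3)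

{-# OPTIONS --safe #-}
module Submission where

-- Apéry's sequences A n = Σₖ t(n,k)² and B n = Σₖ t(n,k)² c(n,k), where
-- t(n,k) = C(n,k) C(n+k,k) and c(n,k) = 2 Σ_{m≤n} 1/m³ + Σ_{m≤k} (-1)^{m-1}/(m³ t(n,m)),
-- satisfy the same three-term recurrence (creative telescoping), and c(n,k) → 2ζ(3)
-- uniformly in k, so that B n / A n → 2ζ(3).  Up to explicit positive factors, the
-- denominators and numerators of the first continued fraction are A (n+1) - A n and
-- B (n+1) - B n, those of the second are A (n+1) + A n and B (n+1) + B n; since
-- A (n+1) ≥ 2 A n, no cancellation spoils the limit.

open import Defs

open import Agda.Builtin.FromNat using (Number; fromNat)
open import Data.Empty using (⊥-elim)
open import Data.Integer as ℤ using (ℤ; +_; -[1+_])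
import Data.Integer.Properties as ℤ
open import Data.Nat as ℕ using (ℕ; zero; suc)
import Data.Nat.Literals as ℕ
import Data.Nat.Properties as ℕ
open import Data.Product using (∃; _×_; _,_; proj₁; proj₂)
open import Data.Rational as ℚ using (ℚ; mkℚ; 0ℚ; 1ℚ; ½; _+_; _*_; _-_; -_; _/_; _≤_; _<_; ∣_∣; toℚᵘ)
open import Data.Rational.Literals as ℚ using (fromℤ)
import Data.Rational.Properties as ℚ
open import Data.Rational.Unnormalised as ℚᵘ using (mkℚᵘ; *≡*)
import Data.Rational.Unnormalised.Properties as ℚᵘ
open import Data.Sum using (inj₁; inj₂)
open import Data.Unit using (tt)
open import Level using (0ℓ)
open import Relation.Binary.PropositionalEquality using (_≡_; _≢_; refl; sym; trans; cong; cong₂; subst; subst₂; module ≡-Reasoning)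
open import Relation.Nullary.Decidable using (dec⇒maybe; from-yes)
open import Tactic.RingSolver using (solve-∀)
open import Tactic.RingSolver.Core.AlmostCommutativeRing as ACR using (AlmostCommutativeRing)

-- Write `L n` for the recurrence that relates `X n`, `X (n+1)`, `X (n+2)`. A combination of
-- `L (n+1)` and `L n` that annihilates constant sequences contains the `X` only through consecutive
-- differences, so it is a three-term recurrence for these; one that annihilates `(-1)^n` does the
-- same for consecutive sums. The left side of `L n` is `-4(2n+3)³` on the constant 1, and
-- `6(2n+3)((n+2)³-(n+1)³)` up to sign on `(-1)^n`. These two values dictate the weights of the
-- combinations and explain the factors in the partial numerators of the two fractions. All
-- identities are polynomial identities modulo relations such as `(k+1) * inv k = 1`. The ring
-- solver cannot use these, so each proof names the multiples of the relations explicitly through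
-- `modulo`.

instance
  ℕ-literals : Number ℕ
  ℕ-literals = ℕ.number

  ℚ-literals : Number ℚ
  ℚ-literals = ℚ.number

ℚ-ring : AlmostCommutativeRing 0ℓ 0ℓ
ℚ-ring = ACR.fromCommutativeRing ℚ.+-*-commutativeRing (λ x → dec⇒maybe (0ℚ ℚ.≟ x))

open AlmostCommutativeRing ℚ-ring using (_^_)

-- Embedding integers and reciprocals into the rationals

fromℤ-homo-+ : ∀ i j → fromℤ (i ℤ.+ j) ≡ fromℤ i + fromℤ j
fromℤ-homo-+ i j = ℚ.toℚᵘ-injective (ℚᵘ.≃-trans
  (*≡* (cong (ℤ._* + 1) (sym (cong₂ ℤ._+_ (ℤ.*-identityʳ i) (ℤ.*-identityʳ j)))))
  (ℚᵘ.≃-sym (ℚ.toℚᵘ-homo-+ (fromℤ i) (fromℤ j))))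

fromℤ-homo-* : ∀ i j → fromℤ (i ℤ.* j) ≡ fromℤ i * fromℤ j
fromℤ-homo-* i j = ℚ.toℚᵘ-injective (ℚᵘ.≃-sym (ℚ.toℚᵘ-homo-* (fromℤ i) (fromℤ j)))

fromℤ-homo-neg : ∀ i → fromℤ (ℤ.- i) ≡ - fromℤ i
fromℤ-homo-neg i = ℚ.toℚᵘ-injective (ℚᵘ.≃-sym (ℚ.toℚᵘ-homo‿- (fromℤ i)))

/-cancel : ∀ i n → (i / suc n) * fromℤ (+ suc n) ≡ fromℤ i
/-cancel i n = ℚ.toℚᵘ-injective (begin
  toℚᵘ ((i / suc n) * fromℤ (+ suc n))       ≈⟨ ℚ.toℚᵘ-homo-* (i / suc n) (fromℤ (+ suc n)) ⟩
  toℚᵘ (i / suc n) ℚᵘ.* mkℚᵘ (+ suc n) 0     ≈⟨ ℚᵘ.*-congʳ (ℚ.toℚᵘ-fromℚᵘ (mkℚᵘ i n)) ⟩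
  mkℚᵘ i n ℚᵘ.* mkℚᵘ (+ suc n) 0             ≈⟨ *≡* (ℤ.*-assoc i (+ suc n) (+ 1)) ⟩
  mkℚᵘ i 0                                   ∎)
  where open ℚᵘ.≃-Reasoning

-- Defined by recursion so that ι (suc n) unfolds for the ring solver.
ι : ℕ → ℚ
ι zero    = 0
ι (suc n) = 1 + ι n

ι≡fromℤ : ∀ n → ι n ≡ fromℤ (+ n)
ι≡fromℤ zero    = refl
ι≡fromℤ (suc n) = trans (cong (λ x → 1 + x) (ι≡fromℤ n)) (sym (fromℤ-homo-+ (+ 1) (+ n)))

-- inv k = 1/(k+1)
inv : ℕ → ℚ
inv k = + 1 / suc k

ι-inv : ∀ k → ι (suc k) * inv k ≡ 1
ι-inv k = trans (cong (_* inv k) (ι≡fromℤ (suc k))) (trans (ℚ.*-comm (fromℤ (+ suc k)) (inv k)) (/-cancel (+ 1) k))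

-- To derive l ≡ r from x ≡ y it suffices to exhibit l - r as a multiple of x - y.
modulo : ∀ {x y l r} c → x ≡ y → l ≡ r + c * (x - y) → l ≡ r
modulo {x} {r = r} c refl l≡ = trans l≡ (drop r c x)
  where
  drop : ∀ r c x → r + c * (x - x) ≡ r
  drop = solve-∀ ℚ-ring

-- The Apéry recurrence

sgn : ℕ → ℚ
sgn zero    = 1
sgn (suc k) = - sgn k

ρ : ℕ → ℕ → ℚ
ρ n k = (ι n - ι k) * (ι n + ι k + 1) * inv k ^ 2

-- t n k = C(n,k) C(n+k,k), which vanishes for k > n.
t : ℕ → ℕ → ℚ
t n zero    = 1
t n (suc k) = ρ n k * t n k

-- A step from `t n k` to `t (suc n) k` would divide by `n + 1 - k`, which vanishes at `k = n + 1`.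
-- The diagonal steps here and in `t-down` avoid this and express the terms of the recurrence at
-- `k + 1` through the single value at `(n + 1, k)`.
t-up : ∀ n k → t (suc n) (suc k) ≡ (ι n + ι k + 1) * (ι n + ι k + 2) * inv k ^ 2 * t n k
t-up n zero = poly (ι n) (inv 0)
  where
  poly : ∀ N x → (1 + N - 0) * (1 + N + 0 + 1) * x ^ 2 * 1 ≡ (N + 0 + 1) * (N + 0 + 2) * x ^ 2 * 1
  poly = solve-∀ ℚ-ring
t-up n (suc k) = trans (cong (ρ (suc n) (suc k) *_) (t-up n k)) (poly (ι n) (ι k) (inv k) (inv (suc k)) (t n k))
  where
  poly : ∀ N K x y T →
         (1 + N - (1 + K)) * (1 + N + (1 + K) + 1) * y ^ 2 * ((N + K + 1) * (N + K + 2) * x ^ 2 * T)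
       ≡ (N + (1 + K) + 1) * (N + (1 + K) + 2) * y ^ 2 * ((N - K) * (N + K + 1) * x ^ 2 * T)
  poly = solve-∀ ℚ-ring

t-down : ∀ n k → t n (suc k) ≡ (ι n - ι k) * (ι n + 1 - ι k) * inv k ^ 2 * t (suc n) k
t-down n zero = poly (ι n) (inv 0)
  where
  poly : ∀ N x → (N - 0) * (N + 0 + 1) * x ^ 2 * 1 ≡ (N - 0) * (N + 1 - 0) * x ^ 2 * 1
  poly = solve-∀ ℚ-ring
t-down n (suc k) = trans (cong (ρ n (suc k) *_) (t-down n k)) (poly (ι n) (ι k) (inv k) (inv (suc k)) (t (suc n) k))
  where
  poly : ∀ N K x y T →
         (N - (1 + K)) * (N + (1 + K) + 1) * y ^ 2 * ((N - K) * (N + 1 - K) * x ^ 2 * T)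
       ≡ (N - (1 + K)) * (N + 1 - (1 + K)) * y ^ 2 * ((1 + N - K) * (1 + N + K + 1) * x ^ 2 * T)
  poly = solve-∀ ℚ-ring

module _ (s η : ℚ) where

  -- All that follows is linear in `(s, η)`: the pair `(1, 0)` gives Apéry's denominators and
  -- `(0, 2)` his numerators, so each identity is proved once for both.
  S : ℕ → ℚ
  S zero    = s
  S (suc n) = S n + η * inv n ^ 3

  -- w n k = t n k * (S n + (η/2) Σ_{m≤k} (-1)^(m-1) / (m³ t n m)) for k ≤ n, in a form that
  -- makes sense for all k and so removes the boundary cases from the telescoping below.
  w : ℕ → ℕ → ℚ
  w n zero    = S n
  w n (suc k) = ρ n k * w n k + η * (sgn k * (½ * inv k ^ 3))

  -- For `k ≤ n` this is Apéry's closed form of `c(n+1,k) - c(n,k)`, here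
  -- `η (-1)^k / ((n+1)² (n+k+1) t(n,k))`, multiplied by `(n+1+k) t(n,k) = (n+1-k) t(n+1,k)`.
  w-shift : ∀ n k → (ι n + 1 - ι k) * w (suc n) k ≡ (ι n + 1 + ι k) * w n k + η * (sgn k * inv n ^ 2)
  w-shift n zero = modulo (η * inv n ^ 2) (ι-inv n) (poly η (ι n) (S n) (inv n))
    where
    poly : ∀ η N S y → (N + 1 - 0) * (S + η * y ^ 3) ≡ (N + 1 + 0) * S + η * (1 * y ^ 2) + η * y ^ 2 * ((1 + N) * y - 1)
    poly = solve-∀ ℚ-ring
  w-shift n (suc k) =
    -- After the induction hypothesis the remainder vanishes because
    -- `(n-k)(n+k+2) = (n+1)² - (k+1)²`.
    modulo (η * sgn k * inv k ^ 2 * (ι (suc n) * inv n + 1)) (ι-inv n)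
    (modulo (- (η * sgn k * (inv k ^ 2 + inv n ^ 2 * (ι (suc k) * inv k + 1)))) (ι-inv k)
    (modulo ((ι n - ι k) * (ι n + ι k + 2) * inv k ^ 2) (w-shift n k)
    (poly η (ι n) (ι k) (w n k) (w (suc n) k) (sgn k) (inv k) (inv n))))
    where
    poly : ∀ η N K W W₁ σ x y →
           (N + 1 - (1 + K)) * ((1 + N - K) * (1 + N + K + 1) * x ^ 2 * W₁ + η * (σ * (½ * x ^ 3)))
         ≡ (N + 1 + (1 + K)) * ((N - K) * (N + K + 1) * x ^ 2 * W + η * (σ * (½ * x ^ 3))) + η * ((- σ) * y ^ 2)
           + η * σ * x ^ 2 * ((1 + N) * y + 1) * ((1 + N) * y - 1)
           + (- (η * σ * (x ^ 2 + y ^ 2 * ((1 + K) * x + 1)))) * ((1 + K) * x - 1)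
           + (N - K) * (N + K + 2) * x ^ 2 * ((N + 1 - K) * W₁ - ((N + 1 + K) * W + η * (σ * y ^ 2)))
    poly = solve-∀ ℚ-ring

  -- The factor `n + 1 - k` of `ρ (suc n) k` is the very one in `w-shift`, so nothing has to be
  -- divided; in `w-down` it is the factor `n + k + 1` of `ρ n k`.
  w-up : ∀ n k → w (suc n) (suc k) ≡ (ι n + ι k + 2) * ((ι n + ι k + 1) * w n k + η * (sgn k * inv n ^ 2)) * inv k ^ 2
                                    + η * (sgn k * (½ * inv k ^ 3))
  w-up n k = modulo ((ι n + ι k + 2) * inv k ^ 2) (w-shift n k) (poly η (ι n) (ι k) (w n k) (w (suc n) k) (sgn k) (inv k) (inv n))
    where
    poly : ∀ η N K W W₁ σ x y →
           (1 + N - K) * (1 + N + K + 1) * x ^ 2 * W₁ + η * (σ * (½ * x ^ 3))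
         ≡ (N + K + 2) * ((N + K + 1) * W + η * (σ * y ^ 2)) * x ^ 2 + η * (σ * (½ * x ^ 3))
           + (N + K + 2) * x ^ 2 * ((N + 1 - K) * W₁ - ((N + 1 + K) * W + η * (σ * y ^ 2)))
    poly = solve-∀ ℚ-ring

  w-down : ∀ n k → w n (suc k) ≡ (ι n - ι k) * ((ι n + 1 - ι k) * w (suc n) k - η * (sgn k * inv n ^ 2)) * inv k ^ 2
                                + η * (sgn k * (½ * inv k ^ 3))
  w-down n k = modulo ((ι k - ι n) * inv k ^ 2) (w-shift n k) (poly η (ι n) (ι k) (w n k) (w (suc n) k) (sgn k) (inv k) (inv n))
    where
    poly : ∀ η N K W W₁ σ x y →
           (N - K) * (N + K + 1) * x ^ 2 * W + η * (σ * (½ * x ^ 3))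
         ≡ (N - K) * ((N + 1 - K) * W₁ - η * (σ * y ^ 2)) * x ^ 2 + η * (σ * (½ * x ^ 3))
           + (K - N) * x ^ 2 * ((N + 1 - K) * W₁ - ((N + 1 + K) * W + η * (σ * y ^ 2)))
    poly = solve-∀ ℚ-ring

-- Creative telescoping over `k`

∑ : (ℕ → ℚ) → ℕ → ℚ
∑ f zero    = f 0
∑ f (suc k) = ∑ f k + f (suc k)

∑-telescope : ∀ (f g h G : ℕ → ℚ) a b c → a * f 0 - b * g 0 + c * h 0 ≡ G 0 →
              (∀ k → a * f (suc k) - b * g (suc k) + c * h (suc k) ≡ G (suc k) - G k) →
              ∀ k → a * ∑ f k - b * ∑ g k + c * ∑ h k ≡ G k
∑-telescope f g h G a b c base step zero    = base
∑-telescope f g h G a b c base step (suc k) =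
  modulo 1 (step k) (modulo 1 (∑-telescope f g h G a b c base step k)
    (poly a b c (∑ f k) (∑ g k) (∑ h k) (f (suc k)) (g (suc k)) (h (suc k)) (G k) (G (suc k))))
  where
  poly : ∀ a b c F G H f g h u v →
         a * (F + f) - b * (G + g) + c * (H + h)
       ≡ v + 1 * (a * f - b * g + c * h - (v - u)) + 1 * (a * F - b * G + c * H - u)
  poly = solve-∀ ℚ-ring

-- Apéry's polynomial `(2x + 1)(17x² + 17x + 5)`, expanded.
P : ℚ → ℚ
P x = 34 * x ^ 3 + 51 * x ^ 2 + 27 * x + 5

≡1⇒^≡1 : ∀ {x} n → x ≡ 1 → x ^ n ≡ 1
≡1⇒^≡1 zero    refl = refl
≡1⇒^≡1 (suc n) refl = 1^suc n
  where
  1^suc : ∀ n → 1ℚ ^ suc n ≡ 1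
  1^suc zero    = refl
  1^suc (suc n) = trans (ℚ.*-identityʳ (1ℚ ^ suc n)) (1^suc n)

t-vanish : ∀ n → t n (suc n) ≡ 0
t-vanish n = poly (ι n) (inv n) (t n n)
  where
  poly : ∀ N x T → (N - N) * (N + N + 1) * x ^ 2 * T ≡ 0
  poly = solve-∀ ℚ-ring

t-vanish′ : ∀ n → t n (suc (suc n)) ≡ 0
t-vanish′ n = trans (cong (ρ n (suc n) *_) (t-vanish n)) (ℚ.*-zeroʳ (ρ n (suc n)))

module _ (s η : ℚ) where

  private
    f : ℕ → ℕ → ℚ
    f n k = t n k * w s η n k

    f-vanish : ∀ n k → t n k ≡ 0 → f n k ≡ 0
    f-vanish n k t≡0 = trans (cong (_* w s η n k) t≡0) (ℚ.*-zeroˡ (w s η n k))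

  X : ℕ → ℚ
  X n = ∑ (f n) n

  -- The Cohen–Zagier certificate of Apéry's recurrence centred at n + 1.
  certificate : ℕ → ℕ → ℚ
  certificate n k = 4 * (2 * ι (suc n) + 1) * (ι k * (2 * ι k + 1) - (2 * ι (suc n) + 1) ^ 2) * f (suc n) k
                  - 5 * (2 * ι (suc n) + 1) * (sgn k * ι k) * (inv (suc n) * inv n) * η * t (suc n) k

  certificate-vanish : ∀ n → certificate n (suc (suc n)) ≡ 0
  certificate-vanish n = modulo (a * W - c) (t-vanish (suc n)) (poly a c (t (suc n) k) W)
    where
    k = suc (suc n)
    a = 4 * (2 * ι (suc n) + 1) * (ι k * (2 * ι k + 1) - (2 * ι (suc n) + 1) ^ 2)
    c = 5 * (2 * ι (suc n) + 1) * (sgn k * ι k) * (inv (suc n) * inv n) * η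
    W = w s η (suc n) k
    poly : ∀ a c T W → a * (T * W) - c * T ≡ 0 + (a * W - c) * (T - 0)
    poly = solve-∀ ℚ-ring

  -- The three summands are values of `S`. Relative to `S (n+1)`, its two increments contribute `η`
  -- and `-η`, which cancel, and the coefficients add up to `-4(2n+3)³`.
  certificate-zero : ∀ n → ι (suc (suc n)) ^ 3 * f (suc (suc n)) 0 - P (ι (suc n)) * f (suc n) 0 + ι (suc n) ^ 3 * f n 0 ≡ certificate n 0
  certificate-zero n =
    modulo η (≡1⇒^≡1 3 (ι-inv (suc n))) (modulo (- η) (≡1⇒^≡1 3 (ι-inv n))
      (poly η (ι n) (S s η n) (inv (suc n)) (inv n)))
    where
    poly : ∀ η N S y z → let M = 1 + N in
           (1 + M) ^ 3 * (1 * (S + η * z ^ 3 + η * y ^ 3)) - (34 * M ^ 3 + 51 * M ^ 2 + 27 * M + 5) * (1 * (S + η * z ^ 3)) + M ^ 3 * (1 * S)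
         ≡ 4 * (2 * M + 1) * (0 * (2 * 0 + 1) - (2 * M + 1) ^ 2) * (1 * (S + η * z ^ 3)) - 5 * (2 * M + 1) * (1 * 0) * (y * z) * η * 1
           + η * (((1 + M) * y) ^ 3 - 1)
           + (- η) * ((M * z) ^ 3 - 1)
    poly = solve-∀ ℚ-ring

  certificate-suc : ∀ n k → ι (suc (suc n)) ^ 3 * f (suc (suc n)) (suc k) - P (ι (suc n)) * f (suc n) (suc k) + ι (suc n) ^ 3 * f n (suc k)
                          ≡ certificate n (suc k) - certificate n k
  certificate-suc n k = trans
    (cong₂ (λ a b → ι (suc (suc n)) ^ 3 * a - P (ι (suc n)) * f (suc n) (suc k) + ι (suc n) ^ 3 * b)
      (cong₂ _*_ (t-up (suc n) k) (w-up s η (suc n) k)) (cong₂ _*_ (t-down n k) (w-down s η n k)))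
    -- All multiples of `T * W` carry `x ^ 4` except the one from the certificate at `k`; the first
    -- relation supplies the missing power. The other six balance the reciprocals in the multiples
    -- of `η * σ * T`.
    (modulo (- (4 * (2 * M + 1) * (K * (2 * K + 1) - (2 * M + 1) ^ 2) * (T * W))) (≡1⇒^≡1 4 Kx)
    (modulo ((M + 1) * (M + K + 1) * (M + K + 2) ^ 2 * x ^ 4 * (η * σ * T)) (≡1⇒^≡1 2 My)
    (modulo (- (M * (N - K) ^ 2 * (M - K) * x ^ 4 * (η * σ * T))) (≡1⇒^≡1 2 Mz)
    (modulo (- (((M + 1) * (M + K + 1) * (M + K + 2) ^ 2 - M * (N - K) ^ 2 * (M - K)) * x ^ 4 * (η * σ * T))) Kx
    (modulo (5 * (2 * M + 1) * (y * z) * (η * σ * T) * K) (≡1⇒^≡1 2 Kx)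
    (modulo (- (5 * (2 * M + 1) * (η * σ * T) * x ^ 2 * (1 + K))) (cong₂ _*_ My Mz)
    (modulo (5 * (2 * M + 1) * (η * σ * T) * x ^ 2 * (1 + K)) (≡1⇒^≡1 3 Kx)
    (poly η N K T W σ x y z))))))))
    where
    N = ι n
    M = ι (suc n)
    K = ι k
    T = t (suc n) k
    W = w s η (suc n) k
    σ = sgn k
    x = inv k
    y = inv (suc n)
    z = inv n
    Kx = ι-inv k
    My = ι-inv (suc n)
    Mz = ι-inv n
    poly : ∀ η N K T W σ x y z → let M = 1 + N in
           (1 + M) ^ 3 * ((M + K + 1) * (M + K + 2) * x ^ 2 * T * ((M + K + 2) * ((M + K + 1) * W + η * (σ * y ^ 2)) * x ^ 2 + η * (σ * (½ * x ^ 3))))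
         - (34 * M ^ 3 + 51 * M ^ 2 + 27 * M + 5) * ((M - K) * (M + K + 1) * x ^ 2 * T * ((M - K) * (M + K + 1) * x ^ 2 * W + η * (σ * (½ * x ^ 3))))
         + M ^ 3 * ((N - K) * (N + 1 - K) * x ^ 2 * T * ((N - K) * ((N + 1 - K) * W - η * (σ * z ^ 2)) * x ^ 2 + η * (σ * (½ * x ^ 3))))
         ≡ 4 * (2 * M + 1) * ((1 + K) * (2 * (1 + K) + 1) - (2 * M + 1) ^ 2)
           * ((M - K) * (M + K + 1) * x ^ 2 * T * ((M - K) * (M + K + 1) * x ^ 2 * W + η * (σ * (½ * x ^ 3))))
         - 5 * (2 * M + 1) * ((- σ) * (1 + K)) * (y * z) * η * ((M - K) * (M + K + 1) * x ^ 2 * T)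
         - (4 * (2 * M + 1) * (K * (2 * K + 1) - (2 * M + 1) ^ 2) * (T * W) - 5 * (2 * M + 1) * (σ * K) * (y * z) * η * T)
         + (- (4 * (2 * M + 1) * (K * (2 * K + 1) - (2 * M + 1) ^ 2) * (T * W))) * (((1 + K) * x) ^ 4 - 1)
         + (M + 1) * (M + K + 1) * (M + K + 2) ^ 2 * x ^ 4 * (η * σ * T) * (((1 + M) * y) ^ 2 - 1)
         + (- (M * (N - K) ^ 2 * (M - K) * x ^ 4 * (η * σ * T))) * ((M * z) ^ 2 - 1)
         + (- (((M + 1) * (M + K + 1) * (M + K + 2) ^ 2 - M * (N - K) ^ 2 * (M - K)) * x ^ 4 * (η * σ * T))) * ((1 + K) * x - 1)
         + 5 * (2 * M + 1) * (y * z) * (η * σ * T) * K * (((1 + K) * x) ^ 2 - 1)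
         + (- (5 * (2 * M + 1) * (η * σ * T) * x ^ 2 * (1 + K))) * ((1 + M) * y * (M * z) - 1)
         + 5 * (2 * M + 1) * (η * σ * T) * x ^ 2 * (1 + K) * (((1 + K) * x) ^ 3 - 1)
    poly = solve-∀ ℚ-ring

  recurrence : ∀ n → ι (suc (suc n)) ^ 3 * X (suc (suc n)) - P (ι (suc n)) * X (suc n) + ι (suc n) ^ 3 * X n ≡ 0
  recurrence n = begin
    a * X (suc (suc n)) - b * X (suc n) + c * X n
      -- The telescoping needs one common range of summation; rows `n` and `n + 1` extend to `n + 2`
      -- by zeros of `t`.
      ≡⟨ cong₂ (λ u v → a * X (suc (suc n)) - b * u + c * v) X₁ X₀ ⟩
    a * ∑ (f (suc (suc n))) (suc (suc n)) - b * ∑ (f (suc n)) (suc (suc n)) + c * ∑ (f n) (suc (suc n))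
      ≡⟨ ∑-telescope (f (suc (suc n))) (f (suc n)) (f n) (certificate n) a b c (certificate-zero n) (certificate-suc n) (suc (suc n)) ⟩
    certificate n (suc (suc n))
      ≡⟨ certificate-vanish n ⟩
    0 ∎
    where
    open ≡-Reasoning
    a = ι (suc (suc n)) ^ 3
    b = P (ι (suc n))
    c = ι (suc n) ^ 3
    extend : ∀ {x y} → y ≡ 0 → x ≡ x + y
    extend {x} refl = sym (ℚ.+-identityʳ x)
    X₁ : X (suc n) ≡ ∑ (f (suc n)) (suc (suc n))
    X₁ = extend (f-vanish (suc n) (suc (suc n)) (t-vanish (suc n)))
    X₀ : X n ≡ ∑ (f n) (suc (suc n))
    X₀ = trans (extend (f-vanish n (suc n) (t-vanish n))) (extend (f-vanish n (suc (suc n)) (t-vanish′ n)))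

-- The continued fractions

X-zero : ∀ s η → X s η 0 ≡ s
X-zero = poly
  where
  poly : ∀ s (η : ℚ) → 1 * s ≡ s
  poly = solve-∀ ℚ-ring

X-one : ∀ s η → X s η 1 ≡ 5 * s + 6 * η
X-one = poly
  where
  poly : ∀ s η → 1 * (s + η * 1) + 2 * (2 * (s + η * 1) + η * ½) ≡ 5 * s + 6 * η
  poly = solve-∀ ℚ-ring

module _ (a b : ℕ → ℤ) (x₋₁ x₀ : ℤ) where

  private
    x : ℕ → ℤ
    x n = proj₁ (ContRec a b x₋₁ x₀ n)

  ContRec-suc : ∀ n → ContRec a b x₋₁ x₀ (suc n) ≡ (b (suc n) ℤ.* x n ℤ.+ a (suc n) ℤ.* proj₂ (ContRec a b x₋₁ x₀ n) , x n)
  ContRec-suc n with ContRec a b x₋₁ x₀ n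
  ... | u , v = refl

  x-suc-suc : ∀ n → x (suc (suc n)) ≡ b (suc (suc n)) ℤ.* x (suc n) ℤ.+ a (suc (suc n)) ℤ.* x n
  x-suc-suc n = trans (cong proj₁ (ContRec-suc (suc n)))
    (cong (λ r → b (suc (suc n)) ℤ.* x (suc n) ℤ.+ a (suc (suc n)) ℤ.* proj₂ r) (ContRec-suc n))

  -- The values at 0 and 1 serve as the start, since in both fractions `a 1` does not follow the
  -- formula for the later partial numerators.
  ContRec-unique : ∀ C (Y : ℕ → ℚ) → C * fromℤ x₀ ≡ Y 0 → C * fromℤ (b 1 ℤ.* x₀ ℤ.+ a 1 ℤ.* x₋₁) ≡ Y 1 →
                   (∀ n → Y (suc (suc n)) ≡ fromℤ (b (suc (suc n))) * Y (suc n) + fromℤ (a (suc (suc n))) * Y n) →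
                   ∀ n → C * fromℤ (x n) ≡ Y n
  ContRec-unique C Y base₀ base₁ step zero          = base₀
  ContRec-unique C Y base₀ base₁ step (suc zero)    = base₁
  ContRec-unique C Y base₀ base₁ step (suc (suc n)) = begin
    C * fromℤ (x (suc (suc n)))                    ≡⟨ cong (λ i → C * fromℤ i) (x-suc-suc n) ⟩
    C * fromℤ (b₂ ℤ.* x (suc n) ℤ.+ a₂ ℤ.* x n)
      ≡⟨ cong (C *_) (trans (fromℤ-homo-+ (b₂ ℤ.* x (suc n)) (a₂ ℤ.* x n))
           (cong₂ _+_ (fromℤ-homo-* b₂ (x (suc n))) (fromℤ-homo-* a₂ (x n)))) ⟩
    C * (fromℤ b₂ * fromℤ (x (suc n)) + fromℤ a₂ * fromℤ (x n))
      ≡⟨ poly C (fromℤ b₂) (fromℤ (x (suc n))) (fromℤ a₂) (fromℤ (x n)) ⟩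
    fromℤ b₂ * (C * fromℤ (x (suc n))) + fromℤ a₂ * (C * fromℤ (x n))
      ≡⟨ cong₂ (λ u v → fromℤ b₂ * u + fromℤ a₂ * v) (ContRec-unique C Y base₀ base₁ step (suc n)) (ContRec-unique C Y base₀ base₁ step n) ⟩
    fromℤ b₂ * Y (suc n) + fromℤ a₂ * Y n          ≡⟨ step n ⟨
    Y (suc (suc n)) ∎
    where
    open ≡-Reasoning
    b₂ = b (suc (suc n))
    a₂ = a (suc (suc n))
    poly : ∀ C b u a v → C * (b * u + a * v) ≡ b * (C * u) + a * (C * v)
    poly = solve-∀ ℚ-ring

infixl 6 _⊕_ _⊖_
infixl 7 _⊗_
infixr 8 _⊛_

-- With these combinators a proof that `fromℤ` commutes with a polynomial is the polynomial itself,
-- written in circled operators of the usual precedence.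
⊝_ : ∀ {i p} → fromℤ i ≡ p → fromℤ (ℤ.- i) ≡ - p
⊝_ {i} refl = fromℤ-homo-neg i

_⊕_ : ∀ {i j p q} → fromℤ i ≡ p → fromℤ j ≡ q → fromℤ (i ℤ.+ j) ≡ p + q
_⊕_ {i} {j} refl refl = fromℤ-homo-+ i j

_⊖_ : ∀ {i j p q} → fromℤ i ≡ p → fromℤ j ≡ q → fromℤ (i ℤ.- j) ≡ p - q
_⊖_ {i} {j} i≡p j≡q = _⊕_ {i} {ℤ.- j} i≡p (⊝_ {j} j≡q)

_⊗_ : ∀ {i j p q} → fromℤ i ≡ p → fromℤ j ≡ q → fromℤ (i ℤ.* j) ≡ p * q
_⊗_ {i} {j} refl refl = fromℤ-homo-* i j

_⊛_ : ∀ {i p} → fromℤ i ≡ p → ∀ n → fromℤ (i ℤ.^ n) ≡ p ^ n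
_⊛_ {i} eq zero          = refl
-- Integer powers multiply on the left and end in a factor 1; the powers of the ring solver multiply
-- on the right and do not.
_⊛_ {i} {p} eq (suc zero)    = trans (_⊗_ {i} {+ 1} eq refl) (ℚ.*-identityʳ p)
_⊛_ {i} {p} eq (suc (suc n)) = trans (_⊗_ {i} {i ℤ.^ suc n} eq (eq ⊛ suc n)) (ℚ.*-comm p (p ^ suc n))

con : ∀ n → fromℤ (+ n) ≡ fromNat n
con n = refl

fromℤ-b⁽¹⁾ : ∀ k → let ν = ι (suc k) in fromℤ (b⁽¹⁾ (suc k)) ≡ 4 * (68 * ν ^ 6 - 45 * ν ^ 4 + 12 * ν ^ 2 - 1)
fromℤ-b⁽¹⁾ k = con 4 ⊗ (con 68 ⊗ ν ⊛ 6 ⊖ con 45 ⊗ ν ⊛ 4 ⊕ con 12 ⊗ ν ⊛ 2 ⊖ con 1)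
  where ν = sym (ι≡fromℤ (suc k))

fromℤ-a⁽¹⁾ : ∀ k → let ν = ι (suc (suc k)) in
             fromℤ (a⁽¹⁾ (suc (suc k))) ≡ - ((ν - 1) ^ 3 * ν ^ 3 * (4 * ν ^ 2 - 4 * ν - 3) ^ 3)
fromℤ-a⁽¹⁾ k = ⊝ ((ν ⊖ con 1) ⊛ 3 ⊗ ν ⊛ 3 ⊗ (con 4 ⊗ ν ⊛ 2 ⊖ con 4 ⊗ ν ⊖ con 3) ⊛ 3)
  where ν = sym (ι≡fromℤ (suc (suc k)))

fromℤ-b⁽²⁾ : ∀ k → let ν = ι (suc k) in fromℤ (b⁽²⁾ (suc k)) ≡ 2 * (102 * ν ^ 6 - 68 * ν ^ 4 + 21 * ν ^ 2 - 3)
fromℤ-b⁽²⁾ k = con 2 ⊗ (con 102 ⊗ ν ⊛ 6 ⊖ con 68 ⊗ ν ⊛ 4 ⊕ con 21 ⊗ ν ⊛ 2 ⊖ con 3)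
  where ν = sym (ι≡fromℤ (suc k))

fromℤ-a⁽²⁾ : ∀ k → let ν = ι (suc (suc k)) in
             fromℤ (a⁽²⁾ (suc (suc k))) ≡ - ((ν - 1) ^ 3 * ν ^ 3 * (4 * ν ^ 2 - 4 * ν - 3)
               * ((ν + 1) ^ 3 - ν ^ 3) * ((ν - 1) ^ 3 - (ν - 2) ^ 3))
fromℤ-a⁽²⁾ k = ⊝ ((ν ⊖ con 1) ⊛ 3 ⊗ ν ⊛ 3 ⊗ (con 4 ⊗ ν ⊛ 2 ⊖ con 4 ⊗ ν ⊖ con 3)
  ⊗ ((ν ⊕ con 1) ⊛ 3 ⊖ ν ⊛ 3) ⊗ ((ν ⊖ con 1) ⊛ 3 ⊖ (ν ⊖ con 2) ⊛ 3))
  where ν = sym (ι≡fromℤ (suc (suc k)))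

-- The ratio of the values at `n + 2` and `n + 1` is the coefficient `((n+3)(2n+3))³` of the highest
-- difference in the combined recurrence. Rescaling by this product makes the recurrence monic, as
-- the convergents demand.
H⁽¹⁾ : ℕ → ℚ
H⁽¹⁾ zero    = 1
H⁽¹⁾ (suc n) = H⁽¹⁾ n * (ι (suc (suc n)) * (2 * ι n + 1)) ^ 3

-- The same normalisation for consecutive sums; the quadratic factor is `(n+1)³ - n³`.
H⁽²⁾ : ℕ → ℚ
H⁽²⁾ zero    = 1
H⁽²⁾ (suc n) = H⁽²⁾ n * (ι (suc (suc n)) ^ 3 * (2 * ι n + 1) * (3 * ι n ^ 2 + 3 * ι n + 1))

module _ (s η : ℚ) where

  private
    x : ℕ → ℚ
    x = X s η

  continuant⁽¹⁾ : ∀ x₋₁ x₀ → 4 * fromℤ x₀ ≡ 4 * s + 6 * η → 4 * fromℤ (b⁽¹⁾ 1 ℤ.* x₀ ℤ.+ a⁽¹⁾ 1 ℤ.* x₋₁) ≡ 544 * s + 654 * η →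
          ∀ n → 4 * fromℤ (proj₁ (ContRec a⁽¹⁾ b⁽¹⁾ x₋₁ x₀ n)) ≡ H⁽¹⁾ n * (x (suc n) - x n)
  continuant⁽¹⁾ x₋₁ x₀ base₀ base₁ = ContRec-unique a⁽¹⁾ b⁽¹⁾ x₋₁ x₀ 4 Y
    (trans base₀ (sym Y₀)) (trans base₁ (sym Y₁)) step
    where
    Y : ℕ → ℚ
    Y n = H⁽¹⁾ n * (x (suc n) - x n)

    Y₀ : Y 0 ≡ 4 * s + 6 * η
    Y₀ = modulo (- 1ℚ) (X-zero s η) (modulo 1 (X-one s η) (poly (x 0) (x 1) s η))
      where
      poly : ∀ x₀ x₁ s η → 1 * (x₁ - x₀) ≡ 4 * s + 6 * η + (- 1ℚ) * (x₀ - s) + 1 * (x₁ - (5 * s + 6 * η))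
      poly = solve-∀ ℚ-ring

    Y₁ : Y 1 ≡ 544 * s + 654 * η
    -- `recurrence` at 0 reads `8 X₂ = 117 X₁ - X₀` with `117 = P 1`, hence
    -- `8 (X₂ - X₁) = 109 X₁ - X₀`.
    Y₁ = modulo (- 1ℚ) (X-zero s η) (modulo 109 (X-one s η) (modulo 1 (recurrence s η 0) (poly (x 0) (x 1) (x 2) s η)))
      where
      poly : ∀ x₀ x₁ x₂ s η → 8 * (x₂ - x₁) ≡ 544 * s + 654 * η + (- 1ℚ) * (x₀ - s) + 109 * (x₁ - (5 * s + 6 * η))
               + 1 * (8 * x₂ - 117 * x₁ + 1 * x₀ - 0)
      poly = solve-∀ ℚ-ring

    step : ∀ n → Y (suc (suc n)) ≡ fromℤ (b⁽¹⁾ (suc (suc n))) * Y (suc n) + fromℤ (a⁽¹⁾ (suc (suc n))) * Y n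
    step n = trans
      -- On the constant 1 the recurrences at `n + 1` and `n` give `-4(2n+5)³` and `-4(2n+3)³`; the
      -- weights cross these cubes, with the common factor `H⁽¹⁾ (suc n)`.
      (modulo (h * ((2 + N) * (2 * N + 1)) ^ 3 * (2 * N + 3) ^ 3) (recurrence s η (suc n))
      (modulo (- (h * (2 + N) ^ 3 * ((2 * N + 1) * (2 * N + 5)) ^ 3)) (recurrence s η n)
      (poly h N (x n) (x (suc n)) (x (suc (suc n))) (x (suc (suc (suc n)))))))
      (sym (cong₂ (λ b a → b * Y (suc n) + a * Y n) (fromℤ-b⁽¹⁾ (suc n)) (fromℤ-a⁽¹⁾ n)))
      where
      h = H⁽¹⁾ n
      N = ι n
      poly : ∀ h N x₀ x₁ x₂ x₃ → let M = 1 + N ; ν = 1 + M ; γ = (ν * (2 * N + 1)) ^ 3 in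
             h * γ * ((1 + ν) * (2 * M + 1)) ^ 3 * (x₃ - x₂)
           ≡ 4 * (68 * ν ^ 6 - 45 * ν ^ 4 + 12 * ν ^ 2 - 1) * (h * γ * (x₂ - x₁))
             + - ((ν - 1) ^ 3 * ν ^ 3 * (4 * ν ^ 2 - 4 * ν - 3) ^ 3) * (h * (x₁ - x₀))
             + h * ((2 + N) * (2 * N + 1)) ^ 3 * (2 * N + 3) ^ 3
               * ((1 + ν) ^ 3 * x₃ - (34 * ν ^ 3 + 51 * ν ^ 2 + 27 * ν + 5) * x₂ + ν ^ 3 * x₁ - 0)
             + (- (h * (2 + N) ^ 3 * ((2 * N + 1) * (2 * N + 5)) ^ 3))
               * (ν ^ 3 * x₂ - (34 * M ^ 3 + 51 * M ^ 2 + 27 * M + 5) * x₁ + M ^ 3 * x₀ - 0)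
      poly = solve-∀ ℚ-ring

  continuant⁽²⁾ : ∀ x₋₁ x₀ → 6 * fromℤ x₀ ≡ 6 * s + 6 * η → 6 * fromℤ (b⁽²⁾ 1 ℤ.* x₀ ℤ.+ a⁽²⁾ 1 ℤ.* x₋₁) ≡ 624 * s + 750 * η →
          ∀ n → 6 * fromℤ (proj₁ (ContRec a⁽²⁾ b⁽²⁾ x₋₁ x₀ n)) ≡ H⁽²⁾ n * (x (suc n) + x n)
  continuant⁽²⁾ x₋₁ x₀ base₀ base₁ = ContRec-unique a⁽²⁾ b⁽²⁾ x₋₁ x₀ 6 Y
    (trans base₀ (sym Y₀)) (trans base₁ (sym Y₁)) step
    where
    Y : ℕ → ℚ
    Y n = H⁽²⁾ n * (x (suc n) + x n)

    Y₀ : Y 0 ≡ 6 * s + 6 * η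
    Y₀ = modulo 1 (X-zero s η) (modulo 1 (X-one s η) (poly (x 0) (x 1) s η))
      where
      poly : ∀ x₀ x₁ s η → 1 * (x₁ + x₀) ≡ 6 * s + 6 * η + 1 * (x₀ - s) + 1 * (x₁ - (5 * s + 6 * η))
      poly = solve-∀ ℚ-ring

    Y₁ : Y 1 ≡ 624 * s + 750 * η
    Y₁ = modulo (- 1ℚ) (X-zero s η) (modulo 125 (X-one s η) (modulo 1 (recurrence s η 0) (poly (x 0) (x 1) (x 2) s η)))
      where
      poly : ∀ x₀ x₁ x₂ s η → 8 * (x₂ + x₁) ≡ 624 * s + 750 * η + (- 1ℚ) * (x₀ - s) + 125 * (x₁ - (5 * s + 6 * η))
               + 1 * (8 * x₂ - 117 * x₁ + 1 * x₀ - 0)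
      poly = solve-∀ ℚ-ring

    step : ∀ n → Y (suc (suc n)) ≡ fromℤ (b⁽²⁾ (suc (suc n))) * Y (suc n) + fromℤ (a⁽²⁾ (suc (suc n))) * Y n
    step n = trans
      -- On `(-1)^n` the two recurrences give `6(2n+5) q(n+2)` and `6(2n+3) q(n+1)` with opposite
      -- signs; crossed with equal signs they cancel. The common factor is `H⁽²⁾ (suc n)`.
      (modulo (h * ((2 + N) ^ 3 * (2 * N + 1) * q N) * ((2 * N + 3) * q (1 + N))) (recurrence s η (suc n))
      (modulo (h * ((2 + N) ^ 3 * ((2 * N + 1) * (2 * N + 5)) * q (2 + N) * q N)) (recurrence s η n)
      (poly h N (x n) (x (suc n)) (x (suc (suc n))) (x (suc (suc (suc n)))))))
      (sym (cong₂ (λ b a → b * Y (suc n) + a * Y n) (fromℤ-b⁽²⁾ (suc n)) (fromℤ-a⁽²⁾ n)))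
      where
      h = H⁽²⁾ n
      N = ι n
      q : ℚ → ℚ
      q x = 3 * x ^ 2 + 3 * x + 1
      poly : ∀ h N x₀ x₁ x₂ x₃ → let M = 1 + N ; ν = 1 + M ; q₀ = 3 * N ^ 2 + 3 * N + 1 ; q₁ = 3 * M ^ 2 + 3 * M + 1
                                     γ = ν ^ 3 * (2 * N + 1) * q₀ in
             h * γ * ((1 + ν) ^ 3 * (2 * M + 1) * q₁) * (x₃ + x₂)
           ≡ 2 * (102 * ν ^ 6 - 68 * ν ^ 4 + 21 * ν ^ 2 - 3) * (h * γ * (x₂ + x₁))
             + - ((ν - 1) ^ 3 * ν ^ 3 * (4 * ν ^ 2 - 4 * ν - 3) * ((ν + 1) ^ 3 - ν ^ 3) * ((ν - 1) ^ 3 - (ν - 2) ^ 3)) * (h * (x₁ + x₀))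
             + h * ((2 + N) ^ 3 * (2 * N + 1) * q₀) * ((2 * N + 3) * q₁)
               * ((1 + ν) ^ 3 * x₃ - (34 * ν ^ 3 + 51 * ν ^ 2 + 27 * ν + 5) * x₂ + ν ^ 3 * x₁ - 0)
             + h * ((2 + N) ^ 3 * ((2 * N + 1) * (2 * N + 5)) * (3 * (2 + N) ^ 2 + 3 * (2 + N) + 1) * q₀)
               * (ν ^ 3 * x₂ - (34 * M ^ 3 + 51 * M ^ 2 + 27 * M + 5) * x₁ + M ^ 3 * x₀ - 0)
      poly = solve-∀ ℚ-ring

-- Estimates

0≤-+ : ∀ {p q} → 0 ≤ p → 0 ≤ q → 0 ≤ p + q
0≤-+ = ℚ.+-mono-≤

*-monoˡ : ∀ {p q} r → 0 ≤ r → p ≤ q → r * p ≤ r * q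
*-monoˡ r 0≤r p≤q = ℚ.*-monoˡ-≤-nonNeg r {{ℚ.nonNegative 0≤r}} p≤q

*-monoʳ : ∀ {p q} r → 0 ≤ r → p ≤ q → p * r ≤ q * r
*-monoʳ r 0≤r p≤q = ℚ.*-monoʳ-≤-nonNeg r {{ℚ.nonNegative 0≤r}} p≤q

0≤-* : ∀ {p q} → 0 ≤ p → 0 ≤ q → 0 ≤ p * q
0≤-* {p} {q} 0≤p 0≤q = subst (_≤ p * q) (ℚ.*-zeroʳ p) (*-monoˡ p 0≤p 0≤q)

0<-* : ∀ {p q} → 0 < p → 0 < q → 0 < p * q
0<-* {p} {q} 0<p 0<q = subst (_< p * q) (ℚ.*-zeroʳ p) (ℚ.*-monoʳ-<-pos p {{ℚ.positive 0<p}} 0<q)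

0≤-^ : ∀ {p} n → 0 ≤ p → 0 ≤ p ^ n
0≤-^ zero          0≤p = from-yes (0ℚ ℚ.≤? 1ℚ)
0≤-^ (suc zero)    0≤p = 0≤p
0≤-^ (suc (suc n)) 0≤p = 0≤-* (0≤-^ (suc n) 0≤p) 0≤p

0<-^ : ∀ {p} n → 0 < p → 0 < p ^ n
0<-^ zero          0<p = from-yes (0ℚ ℚ.<? 1ℚ)
0<-^ (suc zero)    0<p = 0<p
0<-^ (suc (suc n)) 0<p = 0<-* (0<-^ (suc n) 0<p) 0<p

0≤fromℤ : ∀ n → 0 ≤ fromℤ (+ n)
0≤fromℤ n = ℚ.nonNegative⁻¹ (fromℤ (+ n))

0≤ι : ∀ n → 0 ≤ ι n
0≤ι n = subst (0 ≤_) (sym (ι≡fromℤ n)) (0≤fromℤ n)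

0<ι : ∀ n → 0 < ι (suc n)
0<ι n = ℚ.+-mono-<-≤ (from-yes (0ℚ ℚ.<? 1ℚ)) (0≤ι n)

diff-≥0 : ∀ {p q} → p ≤ q → 0 ≤ q - p
diff-≥0 {p} {q} p≤q = subst (_≤ q - p) (ℚ.+-inverseʳ p) (ℚ.+-monoˡ-≤ (- p) p≤q)

≤-from : ∀ {p q d} → 0 ≤ d → q ≡ p + d → p ≤ q
≤-from {p} {d = d} 0≤d refl = subst (_≤ p + d) (ℚ.+-identityʳ p) (ℚ.+-monoʳ-≤ p 0≤d)

ι-homo-+ : ∀ m n → ι (m ℕ.+ n) ≡ ι m + ι n
ι-homo-+ zero    n = sym (ℚ.+-identityˡ (ι n))
ι-homo-+ (suc m) n = trans (cong (λ x → 1 + x) (ι-homo-+ m n)) (sym (ℚ.+-assoc 1 (ι m) (ι n)))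

ι-mono : ∀ {m n} → m ℕ.≤ n → ι m ≤ ι n
ι-mono {n = n} ℕ.z≤n = 0≤ι n
ι-mono (ℕ.s≤s m≤n) = ℚ.+-monoʳ-≤ 1 (ι-mono m≤n)

0≤inv : ∀ k → 0 ≤ inv k
0≤inv k = ℚ.nonNegative⁻¹ (inv k) {{ℚ.normalize-nonNeg 1 (suc k)}}

-- Lower bounds for `t n k`

w≡t : ∀ n k → w 1 0 n k ≡ t n k
w≡t n zero = S≡1 n
  where
  poly : ∀ s x → s + 0 * x ≡ s
  poly = solve-∀ ℚ-ring
  S≡1 : ∀ n → S 1 0 n ≡ 1
  S≡1 zero    = refl
  S≡1 (suc n) = trans (poly (S 1 0 n) (inv n ^ 3)) (S≡1 n)
w≡t n (suc k) = trans (poly (ρ n k) (w 1 0 n k) (sgn k * (½ * inv k ^ 3))) (cong (ρ n k *_) (w≡t n k))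
  where
  poly : ∀ r w x → r * w + 0 * x ≡ r * w
  poly = solve-∀ ℚ-ring

t-shift : ∀ n k → (ι n + 1 - ι k) * t (suc n) k ≡ (ι n + 1 + ι k) * t n k
t-shift n k = subst₂ (λ u v → (ι n + 1 - ι k) * u ≡ (ι n + 1 + ι k) * v) (w≡t (suc n) k) (w≡t n k)
  (trans (w-shift 1 0 n k) (poly (ι n + 1 + ι k) (w 1 0 n k) (sgn k * inv n ^ 2)))
  where
  poly : ∀ r w x → r * w + 0 * x ≡ r * w
  poly = solve-∀ ℚ-ring

-- t n k is not monotone in k, hence induction on n, starting from the central t k k.
t-lower : ∀ j k → ι (j ℕ.+ suc k) ≤ t (j ℕ.+ suc k) (suc k)
t-lower zero zero    = from-yes (ι 1 ℚ.≤? t 1 1)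
t-lower zero (suc k) = ≤-from
  (0≤-* (0≤inv (suc k)) (0≤-+ (0≤-+ (0≤-+ (0≤-* (0≤fromℤ 3) (0≤-^ 2 (0≤ι k))) (0≤-* (0≤fromℤ 6) (0≤ι k))) (0≤fromℤ 2))
    (0≤-* (0≤-* (0≤fromℤ 2) (0≤-+ (0≤-* (0≤fromℤ 2) (0≤ι (suc k))) (0≤fromℤ 1))) (diff-≥0 (t-lower zero k)))))
  (trans (t-up (suc k) (suc k))
    (modulo (2 * (2 * n + 1) * inv (suc k) * T + (1 + n)) (ι-inv (suc k)) (poly (ι k) (inv (suc k)) T)))
  where
  n = ι (suc k)
  T = t (suc k) (suc k)
  poly : ∀ K x T → let n = 1 + K in
         (n + n + 1) * (n + n + 2) * x ^ 2 * T
       ≡ 1 + n + x * (3 * K ^ 2 + 6 * K + 2 + 2 * (2 * n + 1) * (T - n)) + (2 * (2 * n + 1) * x * T + (1 + n)) * ((1 + n) * x - 1)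
  poly = solve-∀ ℚ-ring
t-lower (suc j) k = ≤-from
  (0≤-* (0≤inv j) (0≤-+
    (0≤-+ (0≤-+ (0≤-+ (0≤-+ (0≤-* (0≤fromℤ 2) (0≤-^ 2 (0≤ι k))) (0≤-* (0≤fromℤ 4) (0≤ι k))) (0≤fromℤ 1))
      (0≤-* (0≤-* (0≤fromℤ 2) (0≤ι k)) (0≤ι j))) (0≤ι j))
    (0≤-* (0≤-+ (0≤-+ (0≤ι n) (0≤fromℤ 1)) (0≤ι (suc k))) (diff-≥0 (t-lower j k)))))
  (modulo (1 + ι n - t (suc n) (suc k)) (ι-inv j) (modulo (inv j) (t-shift n (suc k))
    (identity (ι-homo-+ j (suc k)))))
  where
  n = j ℕ.+ suc k
  poly : ∀ J K y T T₁ → let N = J + (1 + K) in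
         T₁ ≡ 1 + N + y * (2 * K ^ 2 + 4 * K + 1 + 2 * K * J + J + (N + 1 + (1 + K)) * (T - N))
              + (1 + N - T₁) * ((1 + J) * y - 1) + y * ((N + 1 - (1 + K)) * T₁ - (N + 1 + (1 + K)) * T)
  poly = solve-∀ ℚ-ring
  identity : ∀ {N} → N ≡ ι j + ι (suc k) → let T = t n (suc k) ; T₁ = t (suc n) (suc k) ; K = ι k ; J = ι j ; y = inv j in
             T₁ ≡ 1 + N + y * (2 * K ^ 2 + 4 * K + 1 + 2 * K * J + J + (N + 1 + (1 + K)) * (T - N))
                  + (1 + N - T₁) * ((1 + J) * y - 1) + y * ((N + 1 - (1 + K)) * T₁ - (N + 1 + (1 + K)) * T)
  identity refl = poly (ι j) (ι k) (inv j) (t n (suc k)) (t (suc n) (suc k))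

-- The source of uniformity in `k`: each alternating term `1/(m³ t(n,m))` of `c(n,k)` is at most
-- `1/(m³ n)`.
n≤t : ∀ {k n} → suc k ℕ.≤ n → ι n ≤ t n (suc k)
n≤t {k} {n} k<n = subst (λ m → ι m ≤ t m (suc k)) (ℕ.m∸n+n≡m k<n) (t-lower (n ℕ.∸ suc k) k)

0≤t : ∀ {k n} → k ℕ.≤ n → 0 ≤ t n k
0≤t {zero}  _   = 0≤fromℤ 1
0≤t {suc k} {n} k<n = ℚ.≤-trans (0≤ι n) (n≤t k<n)

0≤ρ : ∀ {k n} → k ℕ.≤ n → 0 ≤ ρ n k
0≤ρ {k} {n} k≤n = 0≤-* (0≤-* (diff-≥0 (ι-mono k≤n)) (0≤-+ (0≤-+ (0≤ι n) (0≤ι k)) (0≤fromℤ 1))) (0≤-^ 2 (0≤inv k))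

-- Partial sums of `ζ(3)`

inv³ : ∀ n → + 1 / (suc n ℕ.^ 3) ≡ inv n ^ 3
inv³ n = begin
  r                      ≡⟨ modulo (- r) (≡1⇒^≡1 3 (ι-inv n)) (poly r (ι (suc n)) (inv n)) ⟩
  r * ι (suc n) ^ 3 * inv n ^ 3 ≡⟨ cong (_* inv n ^ 3) r-cancel ⟩
  1 * inv n ^ 3          ≡⟨ ℚ.*-identityˡ (inv n ^ 3) ⟩
  inv n ^ 3              ∎
  where
  open ≡-Reasoning
  instance
    n³≢0 : ℕ.NonZero (suc n ℕ.^ 3)
    n³≢0 = ℕ.m^n≢0 (suc n) 3
  r = + 1 / (suc n ℕ.^ 3)
  poly : ∀ r N x → r ≡ r * N ^ 3 * x ^ 3 + (- r) * ((N * x) ^ 3 - 1)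
  poly = solve-∀ ℚ-ring
  cancel : ∀ m .{{_ : ℕ.NonZero m}} → (+ 1 / m) * fromℤ (+ m) ≡ 1
  cancel (suc m) = /-cancel (+ 1) m
  fromℤ-pos-* : ∀ p q → fromℤ (+ (p ℕ.* q)) ≡ fromℤ (+ p) * fromℤ (+ q)
  fromℤ-pos-* p q = trans (cong fromℤ (ℤ.pos-* p q)) (fromℤ-homo-* (+ p) (+ q))
  cube : ∀ m → fromℤ (+ (m ℕ.^ 3)) ≡ ι m ^ 3
  cube m = trans (trans (fromℤ-pos-* m (m ℕ.* (m ℕ.* 1)))
                   (cong (x *_) (trans (fromℤ-pos-* m (m ℕ.* 1)) (cong (x *_) (fromℤ-pos-* m 1)))))
                 (trans (reorder x) (cong (_^ 3) (sym (ι≡fromℤ m))))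
    where
    x = fromℤ (+ m)
    reorder : ∀ x → x * (x * (x * 1)) ≡ x ^ 3
    reorder = solve-∀ ℚ-ring
  r-cancel : r * ι (suc n) ^ 3 ≡ 1
  r-cancel = trans (cong (r *_) (sym (cube (suc n)))) (cancel (suc n ℕ.^ 3))

ζ : ℕ → ℚ
ζ = ζ3-partial

ζ-suc : ∀ n → ζ (suc n) ≡ ζ n + inv n ^ 3
ζ-suc n = cong (λ x → ζ n + x) (inv³ n)

S≡2ζ : ∀ n → S 0 2 n ≡ 2 * ζ n
S≡2ζ zero    = refl
S≡2ζ (suc n) = trans (cong₂ (λ a b → a + 2 * b) (S≡2ζ n) (sym (inv³ n))) (sym (ℚ.*-distribˡ-+ 2 (ζ n) (+ 1 / (suc n ℕ.^ 3))))
  where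
  instance
    n³≢0 : ℕ.NonZero (suc n ℕ.^ 3)
    n³≢0 = ℕ.m^n≢0 (suc n) 3

ζ-mono : ∀ i n → ζ n ≤ ζ (i ℕ.+ n)
ζ-mono zero    n = ℚ.≤-refl
ζ-mono (suc i) n = ℚ.≤-trans (ζ-mono i n) (≤-from (0≤-^ 3 (0≤inv (i ℕ.+ n))) (ζ-suc (i ℕ.+ n)))

-- ζ (suc n) + 1/(n+1) decreases, as 1/(n+2)³ ≤ 1/(n+1) - 1/(n+2).
ζ-tail : ∀ i n → ζ (i ℕ.+ suc n) + inv (i ℕ.+ n) ≤ ζ (suc n) + inv n
ζ-tail zero    n = ℚ.≤-refl
ζ-tail (suc i) n = ℚ.≤-trans (subst (λ a → ζ (suc a) + inv (suc (i ℕ.+ n)) ≤ ζ a + inv (i ℕ.+ n)) (sym (ℕ.+-suc i n)) (step (i ℕ.+ n))) (ζ-tail i n)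
  where
  step : ∀ m → ζ (suc (suc m)) + inv (suc m) ≤ ζ (suc m) + inv m
  step m = ≤-from (0≤-* (0≤inv (suc m)) (0≤-+ (0≤-* (0≤inv m) (0≤inv (suc m))) (0≤-* (0≤-^ 2 (0≤inv (suc m))) (0≤ι (suc m)))))
    (sym (trans (cong (λ u → u + inv (suc m) + d) (ζ-suc (suc m)))
      (modulo (- (b + b ^ 2)) (ι-inv m) (modulo (b ^ 2 + a + a * b) (ι-inv (suc m)) (poly (ζ (suc m)) (ι m) (inv m) (inv (suc m)))))))
    where
    d = inv (suc m) * (inv m * inv (suc m) + inv (suc m) ^ 2 * ι (suc m))
    a = inv m
    b = inv (suc m)
    poly : ∀ z m a b → let M = 1 + m in z + b ^ 3 + b + b * (a * b + b ^ 2 * M) ≡ z + a + (- (b + b ^ 2)) * (M * a - 1) + (b ^ 2 + a + a * b) * ((1 + M) * b - 1)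
    poly = solve-∀ ℚ-ring

ζ≤2 : ∀ n → ζ n ≤ 2
ζ≤2 zero    = 0≤fromℤ 2
ζ≤2 (suc n) = ℚ.≤-trans (≤-from (0≤inv (n ℕ.+ 0)) refl)
  (subst (λ m → ζ m + inv (n ℕ.+ 0) ≤ 2) (ℕ.+-comm n 1) (ζ-tail n 0))

-- The error of `B n / A n`

∣sgn∣ : ∀ k → ∣ sgn k ∣ ≡ 1
∣sgn∣ zero    = refl
∣sgn∣ (suc k) = trans (ℚ.∣-p∣≡∣p∣ (sgn k)) (∣sgn∣ k)

-- This is `∣c(n,k) - S n∣ ≤ ζ k / n`, cleared of denominators so that the induction can follow the
-- recursion of `w`.
w-bound : ∀ {n} k → k ℕ.≤ n → ι n * ∣ w 0 2 n k - S 0 2 n * t n k ∣ ≤ ζ k * t n k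
w-bound {n} zero _ = ℚ.≤-reflexive (begin
  ι n * ∣ S 0 2 n - S 0 2 n * 1 ∣   ≡⟨ cong (λ x → ι n * ∣ x ∣) (poly (S 0 2 n)) ⟩
  ι n * 0                           ≡⟨ ℚ.*-zeroʳ (ι n) ⟩
  0                                 ∎)
  where
  open ≡-Reasoning
  poly : ∀ s → s - s * 1 ≡ 0
  poly = solve-∀ ℚ-ring
w-bound {n} (suc k) k<n = begin
  ι n * ∣ w 0 2 n (suc k) - S 0 2 n * t n (suc k) ∣
    ≡⟨ cong (λ x → ι n * ∣ x ∣) (split (ρ n k) (w 0 2 n k) (sgn k) (inv k) (S 0 2 n) (t n k)) ⟩
  ι n * ∣ ρ n k * e + sgn k * inv k ^ 3 ∣
    ≤⟨ *-monoˡ (ι n) (0≤ι n) (ℚ.∣p+q∣≤∣p∣+∣q∣ (ρ n k * e) (sgn k * inv k ^ 3)) ⟩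
  ι n * (∣ ρ n k * e ∣ + ∣ sgn k * inv k ^ 3 ∣)
    ≡⟨ cong (ι n *_) (cong₂ _+_ ∣ρe∣ ∣sgnx∣) ⟩
  ι n * (ρ n k * ∣ e ∣ + inv k ^ 3)
    ≡⟨ distribute (ι n) (ρ n k) ∣ e ∣ (inv k ^ 3) ⟩
  ρ n k * (ι n * ∣ e ∣) + inv k ^ 3 * ι n
    ≤⟨ ℚ.+-mono-≤ (*-monoˡ (ρ n k) (0≤ρ k≤n) (w-bound k k≤n)) (*-monoˡ (inv k ^ 3) (0≤-^ 3 (0≤inv k)) (n≤t k<n)) ⟩
  ρ n k * (ζ k * t n k) + inv k ^ 3 * (ρ n k * t n k)
    ≡⟨ collect (ρ n k) (ζ k) (t n k) (inv k ^ 3) ⟩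
  (ζ k + inv k ^ 3) * t n (suc k)
    ≡⟨ cong (_* t n (suc k)) (ζ-suc k) ⟨
  ζ (suc k) * t n (suc k) ∎
  where
  open ℚ.≤-Reasoning
  k≤n = ℕ.<⇒≤ k<n
  e = w 0 2 n k - S 0 2 n * t n k
  ∣ρe∣ : ∣ ρ n k * e ∣ ≡ ρ n k * ∣ e ∣
  ∣ρe∣ = trans (ℚ.∣p*q∣≡∣p∣*∣q∣ (ρ n k) e) (cong (_* ∣ e ∣) (ℚ.0≤p⇒∣p∣≡p (0≤ρ k≤n)))
  ∣sgnx∣ : ∣ sgn k * inv k ^ 3 ∣ ≡ inv k ^ 3
  ∣sgnx∣ = trans (ℚ.∣p*q∣≡∣p∣*∣q∣ (sgn k) (inv k ^ 3))
    (trans (cong₂ _*_ (∣sgn∣ k) (ℚ.0≤p⇒∣p∣≡p (0≤-^ 3 (0≤inv k)))) (ℚ.*-identityˡ (inv k ^ 3)))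
  split : ∀ r w σ x s t → r * w + 2 * (σ * (½ * x ^ 3)) - s * (r * t) ≡ r * (w - s * t) + σ * x ^ 3
  split = solve-∀ ℚ-ring
  distribute : ∀ n r e x → n * (r * e + x) ≡ r * (n * e) + x * n
  distribute = solve-∀ ℚ-ring
  collect : ∀ r z t x → r * (z * t) + x * (r * t) ≡ (z + x) * (r * t)
  collect = solve-∀ ℚ-ring

∑-bound : ∀ (f g : ℕ → ℚ) N s C n → 0 ≤ N → (∀ {k} → k ℕ.≤ n → N * ∣ f k - s * g k ∣ ≤ C * g k) →
          ∀ k → k ℕ.≤ n → N * ∣ ∑ f k - s * ∑ g k ∣ ≤ C * ∑ g k
∑-bound f g N s C n 0≤N bound zero    k≤n = bound k≤n
∑-bound f g N s C n 0≤N bound (suc k) k<n = begin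
  N * ∣ ∑ f k + f (suc k) - s * (∑ g k + g (suc k)) ∣
    ≡⟨ cong (λ x → N * ∣ x ∣) (split (∑ f k) (f (suc k)) s (∑ g k) (g (suc k))) ⟩
  N * ∣ (∑ f k - s * ∑ g k) + (f (suc k) - s * g (suc k)) ∣
    ≤⟨ *-monoˡ N 0≤N (ℚ.∣p+q∣≤∣p∣+∣q∣ (∑ f k - s * ∑ g k) (f (suc k) - s * g (suc k))) ⟩
  N * (∣ ∑ f k - s * ∑ g k ∣ + ∣ f (suc k) - s * g (suc k) ∣)
    ≡⟨ ℚ.*-distribˡ-+ N ∣ ∑ f k - s * ∑ g k ∣ ∣ f (suc k) - s * g (suc k) ∣ ⟩
  N * ∣ ∑ f k - s * ∑ g k ∣ + N * ∣ f (suc k) - s * g (suc k) ∣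
    ≤⟨ ℚ.+-mono-≤ (∑-bound f g N s C n 0≤N bound k (ℕ.<⇒≤ k<n)) (bound k<n) ⟩
  C * ∑ g k + C * g (suc k)
    ≡⟨ ℚ.*-distribˡ-+ C (∑ g k) (g (suc k)) ⟨
  C * (∑ g k + g (suc k)) ∎
  where
  open ℚ.≤-Reasoning
  split : ∀ F f s G g → F + f - s * (G + g) ≡ (F - s * G) + (f - s * g)
  split = solve-∀ ℚ-ring

A B : ℕ → ℚ
A = X 1 0
B = X 0 2

-- `B n / A n` is the mean of the `c(n,k)` with weights `t²`, so it inherits their uniform error
-- `2 / n`, where 2 bounds every `ζ k`.
B-bound : ∀ n → ι n * ∣ B n - S 0 2 n * A n ∣ ≤ 2 * A n
B-bound n = ∑-bound (λ k → t n k * w 0 2 n k) (λ k → t n k * w 1 0 n k) (ι n) (S 0 2 n) 2 n (0≤ι n) term n ℕ.≤-refl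
  where
  open ℚ.≤-Reasoning
  factor : ∀ t w s → t * w - s * (t * t) ≡ t * (w - s * t)
  factor = solve-∀ ℚ-ring
  swap : ∀ n t x → n * (t * x) ≡ t * (n * x)
  swap = solve-∀ ℚ-ring
  swap′ : ∀ t → t * (2 * t) ≡ 2 * (t * t)
  swap′ = solve-∀ ℚ-ring
  term : ∀ {k} → k ℕ.≤ n → ι n * ∣ t n k * w 0 2 n k - S 0 2 n * (t n k * w 1 0 n k) ∣ ≤ 2 * (t n k * w 1 0 n k)
  term {k} k≤n = begin
    ι n * ∣ T * W - S 0 2 n * (T * w 1 0 n k) ∣   ≡⟨ cong (λ x → ι n * ∣ T * W - S 0 2 n * (T * x) ∣) (w≡t n k) ⟩
    ι n * ∣ T * W - S 0 2 n * (T * T) ∣           ≡⟨ cong (λ x → ι n * ∣ x ∣) (factor T W (S 0 2 n)) ⟩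
    ι n * ∣ T * (W - S 0 2 n * T) ∣
      ≡⟨ cong (ι n *_) (trans (ℚ.∣p*q∣≡∣p∣*∣q∣ T (W - S 0 2 n * T))
           (cong (_* ∣ W - S 0 2 n * T ∣) (ℚ.0≤p⇒∣p∣≡p (0≤t k≤n)))) ⟩
    ι n * (T * ∣ W - S 0 2 n * T ∣)               ≡⟨ swap (ι n) T ∣ W - S 0 2 n * T ∣ ⟩
    T * (ι n * ∣ W - S 0 2 n * T ∣)               ≤⟨ *-monoˡ T (0≤t k≤n) (w-bound k k≤n) ⟩
    T * (ζ k * T)                                 ≤⟨ *-monoˡ T (0≤t k≤n) (*-monoʳ T (0≤t k≤n) (ζ≤2 k)) ⟩
    T * (2 * T)                                   ≡⟨ swap′ T ⟩
    2 * (T * T)                                   ≡⟨ cong (λ x → 2 * (T * x)) (w≡t n k) ⟨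
    2 * (T * w 1 0 n k)                           ∎
    where
    T = t n k
    W = w 0 2 n k

-- With `M = n + 1` the recurrence gives `(M+1)³ (A₂ - 2 A₁) = (P M - 2(M+1)³) A₁ - M³
-- A₀`, which is nonnegative once `A₁ ≥ 2 A₀ > 0`; hence the joint induction.
A-growth : ∀ n → 0 < A n × 2 * A n ≤ A (suc n)
A-growth zero = from-yes (0ℚ ℚ.<? A 0) , from-yes (2 * A 0 ℚ.≤? A 1)
A-growth (suc n) = 0<A₁ , ≤-from
  (0≤-* (0≤-^ 3 (0≤inv (suc n))) (0≤-+
    (0≤-* (0≤-+ (0≤-+ (0≤-+ (0≤-* (0≤fromℤ 63) (0≤-^ 3 0≤M)) (0≤-* (0≤fromℤ 90) (0≤-^ 2 0≤M))) (0≤-* (0≤fromℤ 42) 0≤M)) (0≤fromℤ 6)) (ℚ.<⇒≤ 0<A₀))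
    (0≤-* (0≤-+ (0≤-+ (0≤-+ (0≤-* (0≤fromℤ 32) (0≤-^ 3 0≤M)) (0≤-* (0≤fromℤ 45) (0≤-^ 2 0≤M))) (0≤-* (0≤fromℤ 21) 0≤M)) (0≤fromℤ 3)) (diff-≥0 2A₀≤A₁))))
  (modulo (2 * A (suc n) - A (suc (suc n))) (≡1⇒^≡1 3 (ι-inv (suc n))) (modulo (inv (suc n) ^ 3) (recurrence 1 0 n)
    (poly (ι (suc n)) (inv (suc n)) (A n) (A (suc n)) (A (suc (suc n))))))
  where
  0<A₀ = proj₁ (A-growth n)
  2A₀≤A₁ = proj₂ (A-growth n)
  0<A₁ = ℚ.<-≤-trans (0<-* (from-yes (0ℚ ℚ.<? 2)) 0<A₀) 2A₀≤A₁
  0≤M = 0≤ι (suc n)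
  poly : ∀ M y A₀ A₁ A₂ →
         A₂ ≡ 2 * A₁ + y ^ 3 * ((63 * M ^ 3 + 90 * M ^ 2 + 42 * M + 6) * A₀ + (32 * M ^ 3 + 45 * M ^ 2 + 21 * M + 3) * (A₁ - 2 * A₀))
              + (2 * A₁ - A₂) * (((1 + M) * y) ^ 3 - 1)
              + y ^ 3 * ((1 + M) ^ 3 * A₂ - (34 * M ^ 3 + 51 * M ^ 2 + 27 * M + 5) * A₁ + M ^ 3 * A₀ - 0)
  poly = solve-∀ ℚ-ring

0<A : ∀ n → 0 < A n
0<A n = proj₁ (A-growth n)

∣-∣-within : ∀ {a d u v} → a ≤ u → u ≤ a + d → a ≤ v → v ≤ a + d → ∣ u - v ∣ ≤ d
∣-∣-within {a} {d} {u} {v} a≤u u≤ a≤v v≤ with ℚ.∣p∣≡p∨∣p∣≡-p (u - v)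
... | inj₁ eq = subst (_≤ d) (sym eq) (ℚ.≤-trans (ℚ.+-mono-≤ u≤ (ℚ.neg-antimono-≤ a≤v)) (ℚ.≤-reflexive (poly a d)))
  where
  poly : ∀ a d → a + d + - a ≡ d
  poly = solve-∀ ℚ-ring
... | inj₂ eq = subst (_≤ d) (sym eq)
  (ℚ.≤-trans (ℚ.≤-reflexive (swap u v)) (ℚ.≤-trans (ℚ.+-mono-≤ v≤ (ℚ.neg-antimono-≤ a≤u)) (ℚ.≤-reflexive (poly a d))))
  where
  swap : ∀ u v → - (u - v) ≡ v + - u
  swap = solve-∀ ℚ-ring
  poly : ∀ a d → a + d + - a ≡ d
  poly = solve-∀ ℚ-ring

ζ-lower : ∀ {N n} → N ℕ.≤ n → ζ N ≤ ζ n
ζ-lower {N} {n} N≤n = subst (λ m → ζ N ≤ ζ m) (ℕ.m∸n+n≡m N≤n) (ζ-mono (n ℕ.∸ N) N)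

ζ-upper : ∀ {N n} → suc N ℕ.≤ n → ζ n ≤ ζ (suc N) + inv N
ζ-upper {N} {n} N<n = subst (λ m → ζ m ≤ ζ (suc N) + inv N) (ℕ.m∸n+n≡m N<n)
  (ℚ.≤-trans (≤-from (0≤inv (n ℕ.∸ suc N ℕ.+ N)) refl) (ζ-tail (n ℕ.∸ suc N) N))

ζ-close : ∀ {N n m} → suc N ℕ.≤ n → suc N ℕ.≤ m → ∣ ζ n - ζ m ∣ ≤ inv N
ζ-close N<n N<m = ∣-∣-within (ζ-lower N<n) (ζ-upper N<n) (ζ-lower N<m) (ζ-upper N<m)

-- Two errors of `2 * A n` each: from `B n` to the partial sum `ζ n`, and from `ζ n` to `ζ m`.
B-approx : ∀ {N n m} → suc N ℕ.≤ n → suc N ℕ.≤ m → ι (suc N) * ∣ B n - 2 * ζ m * A n ∣ ≤ 4 * A n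
B-approx {N} {n} {m} N<n N<m = begin
  N₁ * ∣ B n - 2 * ζ m * A n ∣
    ≡⟨ cong (λ x → N₁ * ∣ x ∣) (split (B n) (ζ n) (ζ m) (A n)) ⟩
  N₁ * ∣ (B n - 2 * ζ n * A n) + 2 * A n * (ζ n - ζ m) ∣
    ≤⟨ *-monoˡ N₁ 0≤N₁ (ℚ.∣p+q∣≤∣p∣+∣q∣ (B n - 2 * ζ n * A n) (2 * A n * (ζ n - ζ m))) ⟩
  N₁ * (∣ B n - 2 * ζ n * A n ∣ + ∣ 2 * A n * (ζ n - ζ m) ∣)
    ≡⟨ cong (λ x → N₁ * (∣ B n - 2 * ζ n * A n ∣ + x)) (trans (ℚ.∣p*q∣≡∣p∣*∣q∣ (2 * A n) (ζ n - ζ m)) (cong (_* ∣ ζ n - ζ m ∣) (ℚ.0≤p⇒∣p∣≡p 0≤2A))) ⟩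
  N₁ * (∣ B n - 2 * ζ n * A n ∣ + 2 * A n * ∣ ζ n - ζ m ∣)
    ≡⟨ distribute N₁ (∣ B n - 2 * ζ n * A n ∣) (2 * A n) (∣ ζ n - ζ m ∣) ⟩
  N₁ * ∣ B n - 2 * ζ n * A n ∣ + 2 * A n * (N₁ * ∣ ζ n - ζ m ∣)
    ≤⟨ ℚ.+-mono-≤ first (*-monoˡ (2 * A n) 0≤2A (*-monoˡ N₁ 0≤N₁ (ζ-close N<n N<m))) ⟩
  2 * A n + 2 * A n * (N₁ * inv N)
    ≡⟨ cong (λ x → 2 * A n + 2 * A n * x) (ι-inv N) ⟩
  2 * A n + 2 * A n * 1
    ≡⟨ collect (A n) ⟩
  4 * A n ∎
  where
  open ℚ.≤-Reasoning
  N₁ = ι (suc N)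
  0≤N₁ = 0≤ι (suc N)
  0≤2A = 0≤-* (0≤fromℤ 2) (ℚ.<⇒≤ (0<A n))
  first : N₁ * ∣ B n - 2 * ζ n * A n ∣ ≤ 2 * A n
  first = ℚ.≤-trans (*-monoʳ (∣ B n - 2 * ζ n * A n ∣) (ℚ.0≤∣p∣ (B n - 2 * ζ n * A n)) (ι-mono N<n))
    (subst (λ s → ι n * ∣ B n - s * A n ∣ ≤ 2 * A n) (S≡2ζ n) (B-bound n))
  split : ∀ b z z′ a → b - 2 * z′ * a ≡ (b - 2 * z * a) + 2 * a * (z - z′)
  split = solve-∀ ℚ-ring
  distribute : ∀ n x a y → n * (x + a * y) ≡ n * x + a * (n * y)
  distribute = solve-∀ ℚ-ring
  collect : ∀ a → 2 * a + 2 * a * 1 ≡ 4 * a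
  collect = solve-∀ ℚ-ring

-- From linear forms to convergents

ratio-cancel : ∀ p q q≢0 → ratio p q q≢0 * fromℤ q ≡ fromℤ p
ratio-cancel p (+ zero)  q≢0 = ⊥-elim (q≢0 refl)
ratio-cancel p (+ suc n) q≢0 = /-cancel p n
ratio-cancel p -[1+ n ]  q≢0 = begin
  r * fromℤ -[1+ n ]        ≡⟨ cong (r *_) (fromℤ-homo-neg (+ suc n)) ⟩
  r * (- fromℤ (+ suc n))   ≡⟨ poly r (fromℤ (+ suc n)) ⟩
  - (r * fromℤ (+ suc n))   ≡⟨ cong -_ (/-cancel (ℤ.- p) n) ⟩
  - fromℤ (ℤ.- p)           ≡⟨ fromℤ-homo-neg (ℤ.- p) ⟨
  fromℤ (ℤ.- (ℤ.- p))       ≡⟨ cong fromℤ (ℤ.neg-involutive p) ⟩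
  fromℤ p                   ∎
  where
  open ≡-Reasoning
  r = (ℤ.- p) / suc n
  poly : ∀ r x → r * (- x) ≡ - (r * x)
  poly = solve-∀ ℚ-ring

archimedean : ∀ C ε → 0 < ε → ∃ λ N → fromℤ (+ C) < ι (suc N) * ε
archimedean C ε@(mkℚ (+ zero) d _) 0<ε with () ← ℚ.positive 0<ε
archimedean C ε@(mkℚ -[1+ a ] d _) 0<ε with () ← ℚ.positive 0<ε
-- For `ε = (a+1)/(d+1)` the multiplier `(C+1)(d+1)` gives `(C+1)(a+1) > C`; the witness is its
-- predecessor.
archimedean C ε@(mkℚ (+ suc a) d _) 0<ε = d ℕ.+ C ℕ.* suc d , bound
  where
  ε-cancel : ε * ι (suc d) ≡ ι (suc a)
  ε-cancel = trans (cong₂ _*_ (sym (ℚ.↥p/↧p≡p ε)) (ι≡fromℤ (suc d))) (trans (/-cancel (+ suc a) d) (sym (ι≡fromℤ (suc a))))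
  ι-homo-* : ∀ m n → ι (m ℕ.* n) ≡ ι m * ι n
  ι-homo-* zero    n = sym (ℚ.*-zeroˡ (ι n))
  ι-homo-* (suc m) n = trans (ι-homo-+ n (m ℕ.* n)) (trans (cong (λ x → ι n + x) (ι-homo-* m n)) (poly (ι m) (ι n)))
    where
    poly : ∀ m n → n + m * n ≡ (1 + m) * n
    poly = solve-∀ ℚ-ring
  open ℚ.≤-Reasoning
  bound : fromℤ (+ C) < ι (suc C ℕ.* suc d) * ε
  bound = begin-strict
    fromℤ (+ C)                   ≡⟨ ι≡fromℤ C ⟨
    ι C                           ≡⟨ ℚ.+-identityˡ (ι C) ⟨
    0 + ι C                       <⟨ ℚ.+-monoˡ-< (ι C) (from-yes (0ℚ ℚ.<? 1ℚ)) ⟩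
    ι (suc C)                     ≡⟨ ℚ.*-identityʳ (ι (suc C)) ⟨
    ι (suc C) * 1                 ≤⟨ *-monoˡ (ι (suc C)) (0≤ι (suc C)) (ι-mono {1} {suc a} (ℕ.s≤s ℕ.z≤n)) ⟩
    ι (suc C) * ι (suc a)         ≡⟨ cong (ι (suc C) *_) ε-cancel ⟨
    ι (suc C) * (ε * ι (suc d))   ≡⟨ poly (ι (suc C)) ε (ι (suc d)) ⟩
    ι (suc C) * ι (suc d) * ε     ≡⟨ cong (_* ε) (ι-homo-* (suc C) (suc d)) ⟨
    ι (suc C ℕ.* suc d) * ε       ∎
    where
    poly : ∀ c e d → c * (e * d) ≡ c * d * e
    poly = solve-∀ ℚ-ring

module _ (a b : ℕ → ℤ) (C : ℚ) (D E : ℕ → ℚ)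
  (den : ∀ n → C * fromℤ (Den a b n) ≡ D n) (num : ∀ n → C * fromℤ (Num a b n) ≡ E n)
  (0<D : ∀ n → 0 < D n)
  (bound : ∀ {N n m} → suc N ℕ.≤ n → suc N ℕ.≤ m → ι (suc N) * ∣ E n - 2 * ζ m * D n ∣ ≤ 12 * D n)
  where

  Den≢0 : ∀ n → Den a b n ≢ + 0
  Den≢0 n Den≡0 = ℚ.<⇒≢ (0<D n) (sym (trans (sym (den n)) (trans (cong (λ q → C * fromℤ q) Den≡0) (ℚ.*-zeroʳ C))))

  -- The scaling `C` is common to numerator and denominator, so the quotient is `E n / D n` and
  -- multiplying by `D n` gives the linear form in `bound`.
  convergent-bound : ∀ {N n m} → suc N ℕ.≤ n → suc N ℕ.≤ m →
                     ι (suc N) * ∣ ratio (Num a b n) (Den a b n) (Den≢0 n) - 2 * ζ m ∣ ≤ 12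
  convergent-bound {N} {n} {m} N<n N<m = ℚ.*-cancelʳ-≤-pos (D n) {{ℚ.positive (0<D n)}} (begin
    ι (suc N) * ∣ r - z ∣ * D n            ≡⟨ ℚ.*-assoc (ι (suc N)) ∣ r - z ∣ (D n) ⟩
    ι (suc N) * (∣ r - z ∣ * D n)          ≡⟨ cong (λ x → ι (suc N) * (∣ r - z ∣ * x)) (ℚ.0≤p⇒∣p∣≡p (ℚ.<⇒≤ (0<D n))) ⟨
    ι (suc N) * (∣ r - z ∣ * ∣ D n ∣)      ≡⟨ cong (ι (suc N) *_) (ℚ.∣p*q∣≡∣p∣*∣q∣ (r - z) (D n)) ⟨
    ι (suc N) * ∣ (r - z) * D n ∣          ≡⟨ cong (λ x → ι (suc N) * ∣ x ∣) r-z ⟩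
    ι (suc N) * ∣ E n - z * D n ∣          ≤⟨ bound N<n N<m ⟩
    12 * D n                               ∎)
    where
    open ℚ.≤-Reasoning
    r = ratio (Num a b n) (Den a b n) (Den≢0 n)
    z = 2 * ζ m
    r-z : (r - z) * D n ≡ E n - z * D n
    r-z = modulo 1 (num n) (modulo C (ratio-cancel (Num a b n) (Den a b n) (Den≢0 n)) (modulo (- r) (den n)
      (poly r z (D n) (E n) C (fromℤ (Num a b n)) (fromℤ (Den a b n)))))
      where
      poly : ∀ r z D E C p q → (r - z) * D ≡ E - z * D + 1 * (C * p - E) + C * (r * q - p) + (- r) * (C * q - D)
      poly = solve-∀ ℚ-ring

  converges : CFConvergesTo2ζ3 a b
  converges = Den≢0 , λ ε 0<ε → let N , 12<Nε = archimedean 12 ε 0<ε in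
    suc N , λ n m N<n N<m → ℚ.*-cancelˡ-<-nonNeg (ι (suc N)) {{ℚ.nonNegative (0≤ι (suc N))}}
      (ℚ.≤-<-trans (convergent-bound N<n N<m) 12<Nε)

-- Errors of consecutive differences and sums

module _ {N n m : ℕ} (N<n : suc N ℕ.≤ n) (N<m : suc N ℕ.≤ m) where

  private
    ϵ : ℕ → ℚ
    ϵ i = B i - 2 * ζ m * A i

    N≥0 = 0≤ι (suc N)

    errors-bound : ι (suc N) * (∣ ϵ (suc n) ∣ + ∣ ϵ n ∣) ≤ 4 * (A (suc n) + A n)
    errors-bound = begin
      ι (suc N) * (∣ ϵ (suc n) ∣ + ∣ ϵ n ∣)
        ≡⟨ ℚ.*-distribˡ-+ (ι (suc N)) (∣ ϵ (suc n) ∣) (∣ ϵ n ∣) ⟩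
      ι (suc N) * ∣ ϵ (suc n) ∣ + ι (suc N) * ∣ ϵ n ∣
        ≤⟨ ℚ.+-mono-≤ (B-approx (ℕ.m≤n⇒m≤1+n N<n) N<m) (B-approx N<n N<m) ⟩
      4 * A (suc n) + 4 * A n
        ≡⟨ ℚ.*-distribˡ-+ 4 (A (suc n)) (A n) ⟨
      4 * (A (suc n) + A n) ∎
      where open ℚ.≤-Reasoning

  difference-of-consecutive-bound : ι (suc N) * ∣ (B (suc n) - B n) - 2 * ζ m * (A (suc n) - A n) ∣ ≤ 12 * (A (suc n) - A n)
  difference-of-consecutive-bound = begin
    ι (suc N) * ∣ (B (suc n) - B n) - 2 * ζ m * (A (suc n) - A n) ∣
      ≡⟨ cong (λ x → ι (suc N) * ∣ x ∣) (split (B (suc n)) (B n) (2 * ζ m) (A (suc n)) (A n)) ⟩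
    ι (suc N) * ∣ ϵ (suc n) - ϵ n ∣
      ≤⟨ *-monoˡ (ι (suc N)) N≥0 (ℚ.∣p-q∣≤∣p∣+∣q∣ (ϵ (suc n)) (ϵ n)) ⟩
    ι (suc N) * (∣ ϵ (suc n) ∣ + ∣ ϵ n ∣)
      ≤⟨ errors-bound ⟩
    4 * (A (suc n) + A n)
      -- Origin of 12: `4(a₁ + a₀) ≤ 12(a₁ - a₀)` is equivalent to `2 a₀ ≤ a₁`.
      ≤⟨ ≤-from (0≤-* (0≤fromℤ 8) (diff-≥0 (proj₂ (A-growth n)))) (regroup (A (suc n)) (A n)) ⟩
    12 * (A (suc n) - A n) ∎
    where
    open ℚ.≤-Reasoning
    split : ∀ b₁ b₀ z a₁ a₀ → (b₁ - b₀) - z * (a₁ - a₀) ≡ (b₁ - z * a₁) - (b₀ - z * a₀)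
    split = solve-∀ ℚ-ring
    regroup : ∀ a₁ a₀ → 12 * (a₁ - a₀) ≡ 4 * (a₁ + a₀) + 8 * (a₁ - 2 * a₀)
    regroup = solve-∀ ℚ-ring

  sum-of-consecutive-bound : ι (suc N) * ∣ (B (suc n) + B n) - 2 * ζ m * (A (suc n) + A n) ∣ ≤ 12 * (A (suc n) + A n)
  sum-of-consecutive-bound = begin
    ι (suc N) * ∣ (B (suc n) + B n) - 2 * ζ m * (A (suc n) + A n) ∣
      ≡⟨ cong (λ x → ι (suc N) * ∣ x ∣) (split (B (suc n)) (B n) (2 * ζ m) (A (suc n)) (A n)) ⟩
    ι (suc N) * ∣ ϵ (suc n) + ϵ n ∣
      ≤⟨ *-monoˡ (ι (suc N)) N≥0 (ℚ.∣p+q∣≤∣p∣+∣q∣ (ϵ (suc n)) (ϵ n)) ⟩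
    ι (suc N) * (∣ ϵ (suc n) ∣ + ∣ ϵ n ∣)
      ≤⟨ errors-bound ⟩
    4 * (A (suc n) + A n)
      ≤⟨ *-monoʳ (A (suc n) + A n) (0≤-+ (ℚ.<⇒≤ (0<A (suc n))) (ℚ.<⇒≤ (0<A n))) (from-yes (4 ℚ.≤? 12)) ⟩
    12 * (A (suc n) + A n) ∎
    where
    open ℚ.≤-Reasoning
    split : ∀ b₁ b₀ z a₁ a₀ → (b₁ + b₀) - z * (a₁ + a₀) ≡ (b₁ - z * a₁) + (b₀ - z * a₀)
    split = solve-∀ ℚ-ring

scale : ∀ h N x z y C → 0 ≤ h → N * ∣ x - z * y ∣ ≤ C * y → N * ∣ h * x - z * (h * y) ∣ ≤ C * (h * y)
scale h N x z y C 0≤h bound = begin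
  N * ∣ h * x - z * (h * y) ∣   ≡⟨ cong (λ u → N * ∣ u ∣) (factor h x z y) ⟩
  N * ∣ h * (x - z * y) ∣       ≡⟨ cong (N *_) (trans (ℚ.∣p*q∣≡∣p∣*∣q∣ h (x - z * y)) (cong (_* ∣ x - z * y ∣) (ℚ.0≤p⇒∣p∣≡p 0≤h))) ⟩
  N * (h * ∣ x - z * y ∣)       ≡⟨ swap N h (∣ x - z * y ∣) ⟩
  h * (N * ∣ x - z * y ∣)       ≤⟨ *-monoˡ h 0≤h bound ⟩
  h * (C * y)                   ≡⟨ swap h C y ⟩
  C * (h * y)                   ∎
  where
  open ℚ.≤-Reasoning
  factor : ∀ h x z y → h * x - z * (h * y) ≡ h * (x - z * y)
  factor = solve-∀ ℚ-ring
  swap : ∀ a b c → a * (b * c) ≡ b * (a * c)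
  swap = solve-∀ ℚ-ring

0<2n+1 : ∀ n → 0 < 2 * ι n + 1
0<2n+1 n = ℚ.+-mono-≤-< (0≤-* (0≤fromℤ 2) (0≤ι n)) (from-yes (0ℚ ℚ.<? 1ℚ))

0<H⁽¹⁾ : ∀ n → 0 < H⁽¹⁾ n
0<H⁽¹⁾ zero    = from-yes (0ℚ ℚ.<? 1ℚ)
0<H⁽¹⁾ (suc n) = 0<-* (0<H⁽¹⁾ n) (0<-^ 3 (0<-* (0<ι (suc n)) (0<2n+1 n)))

0<H⁽²⁾ : ∀ n → 0 < H⁽²⁾ n
0<H⁽²⁾ zero    = from-yes (0ℚ ℚ.<? 1ℚ)
0<H⁽²⁾ (suc n) = 0<-* (0<H⁽²⁾ n) (0<-* (0<-* (0<-^ 3 (0<ι (suc n))) (0<2n+1 n))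
  (ℚ.+-mono-≤-< (0≤-+ (0≤-* (0≤fromℤ 3) (0≤-^ 2 (0≤ι n))) (0≤-* (0≤fromℤ 3) (0≤ι n))) (from-yes (0ℚ ℚ.<? 1ℚ))))

0<A-difference : ∀ n → 0 < A (suc n) - A n
0<A-difference n = subst (0 <_) (regroup (A (suc n)) (A n)) (ℚ.+-mono-≤-< (diff-≥0 (proj₂ (A-growth n))) (0<A n))
  where
  regroup : ∀ a₁ a₀ → (a₁ - 2 * a₀) + a₀ ≡ a₁ - a₀
  regroup = solve-∀ ℚ-ring

theoremA : CFConvergesTo2ζ3 a⁽¹⁾ b⁽¹⁾ × CFConvergesTo2ζ3 a⁽²⁾ b⁽²⁾
theoremA =
  -- The scalings 4 and 6 are `A 1 - A 0` and `A 1 + A 0`, matching `Q₀ = 1`. The starting values of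
  -- the denominators select `(s, η) = (1, 0)`, those of the numerators `(0, 2)`.
  converges a⁽¹⁾ b⁽¹⁾ 4 (λ n → H⁽¹⁾ n * (A (suc n) - A n)) (λ n → H⁽¹⁾ n * (B (suc n) - B n))
    (continuant⁽¹⁾ 1 0 (+ 0) (+ 1) refl refl)
    (continuant⁽¹⁾ 0 2 (+ 1) (+ 3) refl refl)
    (λ n → 0<-* (0<H⁽¹⁾ n) (0<A-difference n))
    (λ {N} {n} {m} N<n N<m → scale (H⁽¹⁾ n) (ι (suc N)) (B (suc n) - B n) (2 * ζ m) (A (suc n) - A n) 12
      (ℚ.<⇒≤ (0<H⁽¹⁾ n)) (difference-of-consecutive-bound N<n N<m))
  ,
  converges a⁽²⁾ b⁽²⁾ 6 (λ n → H⁽²⁾ n * (A (suc n) + A n)) (λ n → H⁽²⁾ n * (B (suc n) + B n))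
    (continuant⁽²⁾ 1 0 (+ 0) (+ 1) refl refl)
    (continuant⁽²⁾ 0 2 (+ 1) (+ 2) refl refl)
    (λ n → 0<-* (0<H⁽²⁾ n) (ℚ.+-mono-< (0<A (suc n)) (0<A n)))
    (λ {N} {n} {m} N<n N<m → scale (H⁽²⁾ n) (ι (suc N)) (B (suc n) + B n) (2 * ζ m) (A (suc n) + A n) 12
      (ℚ.<⇒≤ (0<H⁽²⁾ n)) (sum-of-consecutive-bound N<n N<m))
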